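{- Let $H$ be a hypergraph containing at least one $2$-edge, and let $H'$ be its $2$-subdivision. If $H$ is degenerate, then so is $H'$.
   Context: A hypergraph $G=(V,E)$ has a finite vertex set and edge set $E\subseteq 2^V$ (edges may have different sizes); $R(G)=\{|F|\colon F\in E\}$. For $G$ on $n$ vertices, $h_n(G)=\sum_{F\in E(G)}1/\binom{n}{|F|}$. $H_1\subseteq H_2$ if there is an injective $f\colon V(H_1)\to V(H_2)$ with $f(F)\in E(H_2)$ for all $F\in E(H_1)$. $\pi_n(H)=\max\{h_n(G)\colon v(G)=n,\ R(G)\subseteq R(H),\ H\not\subseteq G\}$, $\pi(H)=\lim_{n\to\infty}\pi_n(H)$; $H$ is degenerate if $\pi(H)=|R(H)|-1$. If $H$ has $t$ $2$-edges $\{u_1,v_1\},\dots,\{u_t,v_t\}$, its $2$-subdivision is obtained by adding $t$ new vertices $x_1,\dots,x_t$ and replacing each $2$-edge $\{u_i,v_i\}$ by the two $2$-edges $\{u_i,x_i\}$ and $\{x_i,v_i\}$ (all other edges unchanged). -}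

module Defs where

open import Data.Bool using (Bool; true; false; _∧_; _∨_; not; if_then_else_)
open import Data.Nat as ℕ using (ℕ; zero; suc; _+_; _≤_)
open import Data.Nat.Combinatorics using (_C_)
open import Data.Fin using (Fin; zero; suc; _≟_)
open import Data.Fin.Subset as Sub using (Subset; ⁅_⁆; _∩_)
open import Data.Vec using (Vec; []; _∷_; lookup; tabulate; take; drop)
open import Data.List using (List; []; _∷_; map; _++_; filter; foldr)
open import Data.List.Base using (length)
open import Data.Integer using (+_)
open import Data.Rational as ℚ using (ℚ; 0ℚ; 1ℚ; _/_; _-_; ∣_∣)
open import Data.Product using (Σ; ∃; _×_; _,_)
open import Function.Definitions using (Injective)
open import Relation.Binary.PropositionalEquality using (_≡_)
open import Relation.Nullary using (¬_)
open import Relation.Nullary.Decidable using (⌊_⌋)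

Hypergraph : ℕ → Set
Hypergraph n = Subset n → Bool

allSubsets : (n : ℕ) → List (Subset n)
allSubsets zero = [] ∷ []
allSubsets (suc n) = map (true ∷_) (allSubsets n) ++ map (false ∷_) (allSubsets n)

anyFin : {n : ℕ} → (Fin n → Bool) → Bool
anyFin {zero} p = false
anyFin {suc n} p = p zero ∨ anyFin (λ i → p (suc i))

eqSub : {n : ℕ} → Subset n → Subset n → Bool
eqSub [] [] = true
eqSub (x ∷ xs) (y ∷ ys) = (if x then y else not y) ∧ eqSub xs ys

isEmptySub : {n : ℕ} → Subset n → Bool
isEmptySub {n} F = eqSub F Sub.⊥

eqℕ : ℕ → ℕ → Bool
eqℕ m n = ⌊ m ℕ.≟ n ⌋

image : {a b : ℕ} → (Fin a → Fin b) → Subset a → Subset b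
image f F = tabulate (λ j → anyFin (λ i → lookup F i ∧ ⌊ f i ≟ j ⌋))

_⊑_ : {a b : ℕ} → Hypergraph a → Hypergraph b → Set
_⊑_ {a} {b} H₁ H₂ =
  Σ (Fin a → Fin b) λ f → Injective _≡_ _≡_ f ×
    ((F : Subset a) → H₁ F ≡ true → H₂ (image f F) ≡ true)

_RSub_ : {n v : ℕ} → Hypergraph n → Hypergraph v → Set
_RSub_ {n} {v} G H =
  (F : Subset n) → G F ≡ true → ∃ λ (F' : Subset v) → H F' ≡ true × Sub.∣ F ∣ ≡ Sub.∣ F' ∣

-- 1/m as a rational (m = 0 never occurs in the uses below since |F| ≤ n)
inv : ℕ → ℚ
inv zero = 0ℚ
inv (suc m) = + 1 / suc m

h : {n : ℕ} → Hypergraph n → ℚ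
h {n} G = foldr (λ F acc → (if G F then inv (n C Sub.∣ F ∣) else 0ℚ) ℚ.+ acc) 0ℚ (allSubsets n)

hasEdgeOfSize : {v : ℕ} → Hypergraph v → ℕ → Bool
hasEdgeOfSize {v} H k = foldr (λ F acc → (H F ∧ eqℕ Sub.∣ F ∣ k) ∨ acc) false (allSubsets v)

countUpTo : (ℕ → Bool) → ℕ → ℕ
countUpTo p zero = if p zero then 1 else 0
countUpTo p (suc k) = (if p (suc k) then 1 else 0) + countUpTo p k

numSizes : {v : ℕ} → Hypergraph v → ℕ
numSizes {v} H = countUpTo (hasEdgeOfSize H) v

Admissible : {v : ℕ} → Hypergraph v → (n : ℕ) → Hypergraph n → Set
Admissible H n G = (G RSub H) × ¬ (H ⊑ G)

IsPi : {v : ℕ} → Hypergraph v → ℕ → ℚ → Set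
IsPi H n q =
  (∃ λ (G : Hypergraph n) → Admissible H n G × h G ≡ q) ×
  ((G : Hypergraph n) → Admissible H n G → h G ℚ.≤ q)

Degenerate : {v : ℕ} → Hypergraph v → Set
Degenerate H =
  (ε : ℚ) → 0ℚ ℚ.< ε → ∃ λ (N : ℕ) → (n : ℕ) → N ≤ n → (q : ℚ) → IsPi H n q →
    ∣ q - ((+ numSizes H / 1) - 1ℚ) ∣ ℚ.≤ ε

twoEdges : {v : ℕ} → Hypergraph v → List (Subset v)
twoEdges {v} H = filter (λ F → Data.Bool._≟_ (H F ∧ eqℕ Sub.∣ F ∣ 2) true) (allSubsets v)
  where import Data.Bool

numTwoEdges : {v : ℕ} → Hypergraph v → ℕ
numTwoEdges H = length (twoEdges H)

HasTwoEdge : {v : ℕ} → Hypergraph v → Set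
HasTwoEdge {v} H = ∃ λ (F : Subset v) → H F ≡ true × Sub.∣ F ∣ ≡ 2

-- 2-subdivision: vertices Fin (v + t); old vertex u ↦ inject u (first v
-- coordinates), new vertex x_i ↦ position v + i. Edges: every non-2-edge of H
-- (on old vertices), and for the i-th 2-edge {u_i, w_i} the edges
-- {u_i, x_i} and {x_i, w_i}.
subdivide : {v : ℕ} → (H : Hypergraph v) → Hypergraph (v + numTwoEdges H)
subdivide {v} H F' =
  (isEmptySub R ∧ H L ∧ not (eqℕ Sub.∣ L ∣ 2))
  ∨ anyFin (λ i → eqSub R ⁅ i ⁆ ∧ eqℕ Sub.∣ L ∣ 1
                  ∧ eqSub (L ∩ Data.List.lookup (twoEdges H) i) L)
  where
    import Data.List
    L : Subset v
    L = take v F'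
    R : Subset (numTwoEdges H)
    R = drop v F'

{-# OPTIONS --safe #-}
-- Let t be the number of 2-edges of H, v its number of vertices and K = v + t. Given
-- an H'-free G, let G' arise from G by replacing the 2-edges by the pairs with at least
-- K common neighbours. A copy of H in G' extends greedily to a copy of H' in G, so G'
-- is H-free. Moreover G' has asymptotically at least as many 2-edges as G: writing d, d'
-- for the degrees in G, G', counting walks of length two from u gives
--   Σ_{v ~ u} d(v) ≤ d'(u) d(u) + O(n),
-- and, after division by d(u), Σ_u Σ_{v ~ u} d(v)/d(u) ≥ Σ_u d(u) because
-- d(v)/d(u) + d(u)/d(v) ≥ 2. Hence h(G) ≤ h(G') + o(1) ≤ |R(H)| - 1 + o(1). The matching
-- lower bound holds for every hypergraph with a 2-edge: take all sets whose size lies in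
-- R and is not 2.
module Submission where

open import Defs
open import Data.Bool using (Bool; true; false; _∧_; _∨_; not; if_then_else_; T)
import Data.Bool
open import Data.Bool.Properties using (∨-zeroʳ)
open import Data.Fin using (Fin; zero; suc; _≟_)
open import Data.Fin.Properties using (suc-injective)
open import Data.Fin.Subset using (Subset; ⁅_⁆; _∪_; _∩_; ⊥; ∣_∣)
open import Data.Fin.Subset.Properties using (∣⁅x⁆∣≡1; ∣⊥∣≡0; ∪-assoc; ∪-comm; ∪-identityˡ; ∪-identityʳ)
open import Data.Integer as ℤ using (+[1+_])
import Data.Integer.Properties as ℤₚ
open import Data.List using (List; []; _∷_; map; _++_; foldr; cartesianProductWith)
import Data.List as List
open import Data.List.Membership.Propositional using (_∈_)
open import Data.List.Membership.Propositional.Properties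
  using (∈-lookup; ∈-filter⁻; ∈-filter⁺; ∈-map⁺; ∈-++⁺ˡ; ∈-++⁺ʳ; ∈-cartesianProductWith⁺)
open import Data.List.Relation.Unary.Any using (here; there; index)
open import Data.List.Relation.Unary.Any.Properties using (lookup-index)
open import Data.Nat using (ℕ; zero; suc; _+_; _*_; _∸_; _!; _≤_; _<_; z≤n; s≤s; s≤s⁻¹; NonZero; >-nonZero; >-nonZero⁻¹; _≡ᵇ_; _≤ᵇ_)
import Data.Nat as ℕ
open import Data.Nat.Combinatorics using (_C_; nCk+nC[k+1]≡[n+1]C[k+1]; nC1≡n)
open import Data.Nat.Divisibility using (_∣_; ∣-trans; m≤n⇒m!∣n!; m∣m*n)
open import Data.Nat.Properties hiding (_≟_; suc-injective)
import Data.Nat.Properties as ℕₚ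
open import Data.Nat.Tactic.RingSolver using (solve-∀)
open import Data.Product using (∃; _×_; _,_; proj₁; proj₂)
open import Data.Rational as ℚ using (ℚ; mkℚ; 0ℚ; 1ℚ; _/_)
import Data.Rational.Properties as ℚₚ
open import Data.Rational.Solver using (module +-*-Solver)
open import Data.Rational.Unnormalised as ℚᵘ using (mkℚᵘ; *≡*; *≤*)
import Data.Rational.Unnormalised.Properties as ℚᵘₚ
open import Data.Sum using (_⊎_; inj₁; inj₂)
open import Data.Vec using ([]; _∷_; lookup; take; drop) renaming (_++_ to _++ᵥ_)
open import Data.Vec.Properties using (lookup∘tabulate; tabulate∘lookup; tabulate-cong; lookup-zipWith; lookup-replicate; take++drop≡id; ++-injective)
open import Function using (_∘_)
open import Function.Definitions using (Injective)
open import Relation.Binary.PropositionalEquality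
open import Relation.Nullary using (¬_; contradiction; Dec; yes; no)
open import Relation.Nullary.Decidable using (⌊_⌋; decidable-stable)
open import Algebra.Properties.Semiring.Sum +-*-semiring using (sum; ∑-distrib-+; ∑-comm; sum-cong-≗; *-distribˡ-sum; *-distribʳ-sum)
open +-*-Solver using (solve; _:+_; _:*_; _:-_; _:=_)

-- A degree-sum inequality

-- The obstacle is the division by d(u): it is impossible at isolated vertices, and where d(u) is
-- small the error O(n)/d(u) is not o(n). All degrees are therefore shifted by a constant T. The
-- inequality r + 1/r ≥ 2 applies just as well to ratios of the shifted degrees d + T, while the
-- error at each vertex becomes at most K n / T + T. The total error K n²/T + T n drops below any
-- prescribed multiple of n² once T is a large constant and n is large in terms of T; for accuracy
-- 1/m, a T linear in m is enough. The counting stays in ℕ: a common multiple P of all shifted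
-- degrees replaces 1 in the reciprocals. Rationals enter only when edge counts are turned into
-- Lubell weights.

sum-mono : ∀ {n} {f g : Fin n → ℕ} → (∀ i → f i ≤ g i) → sum f ≤ sum g
sum-mono {zero}  f≤g = z≤n
sum-mono {suc n} f≤g = +-mono-≤ (f≤g zero) (sum-mono (λ i → f≤g (suc i)))

sum-const : ∀ n c → sum {n} (λ _ → c) ≡ n * c
sum-const zero    c = refl
sum-const (suc n) c = cong (c +_) (sum-const n c)

-- With f = q - p, the equation x p = y q reads e p = y f, and the right-hand side then exceeds 2 P
-- by exactly e f. Fixing the order of x and y through e keeps every difference in ℕ.
am-gm-step : ∀ {P x p} e {y q} → P ≡ x * p → P ≡ y * q → x ≡ y + e → .{{NonZero y}} → 2 * P ≤ y * p + x * q
am-gm-step {p = p} e {y} {q} refl P≡yq refl = begin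
  2 * ((y + e) * p)                 ≡⟨ lhs y e p ⟩
  2 * (y * p) + e * p + e * p       ≡⟨ cong (2 * (y * p) + e * p +_) ep≡yf ⟩
  2 * (y * p) + e * p + y * f       ≤⟨ m≤m+n _ (e * f) ⟩
  2 * (y * p) + e * p + y * f + e * f ≡⟨ rhs y e p f ⟩
  y * p + (y + e) * (p + f)         ≡⟨ cong (λ z → y * p + (y + e) * z) (m+[n∸m]≡n p≤q) ⟩
  y * p + (y + e) * q               ∎
  where
  open ≤-Reasoning
  p≤q : p ≤ q
  p≤q = *-cancelˡ-≤ y (≤-trans (*-monoˡ-≤ p (m≤m+n y e)) (≤-reflexive P≡yq))
  f = q ∸ p
  lhs : ∀ y e p → 2 * ((y + e) * p) ≡ 2 * (y * p) + e * p + e * p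
  lhs = solve-∀
  rhs : ∀ y e p f → 2 * (y * p) + e * p + y * f + e * f ≡ y * p + (y + e) * (p + f)
  rhs = solve-∀
  ep≡yf : e * p ≡ y * f
  ep≡yf = +-cancelˡ-≡ (y * p) _ _
    (trans (sym (*-distribʳ-+ p y e)) (trans P≡yq (trans (cong (y *_) (sym (m+[n∸m]≡n p≤q))) (*-distribˡ-+ y p f))))

-- d(v)/d(u) + d(u)/d(v) ≥ 2, with p = P / x and q = P / y in place of the inverses.
am-gm : ∀ {P} x p y q → .{{NonZero x}} → .{{NonZero y}} → P ≡ x * p → P ≡ y * q → 2 * P ≤ y * p + x * q
am-gm {P} x p y q P≡xp P≡yq with ≤-total y x
... | inj₁ y≤x = am-gm-step (x ∸ y) P≡xp P≡yq (sym (m+[n∸m]≡n y≤x))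
... | inj₂ x≤y = subst (2 * P ≤_) (+-comm (x * q) (y * p)) (am-gm-step {P} (y ∸ x) P≡yq P≡xp (sym (m+[n∸m]≡n x≤y)))

∣-! : ∀ {m n} → .{{NonZero m}} → m ≤ n → m ∣ n !
∣-! {suc m} m≤n = ∣-trans (m∣m*n (m !)) (m≤n⇒m!∣n! m≤n)

module _ {n : ℕ} (T K : ℕ) .{{_ : NonZero T}} (a b : Fin n → Fin n → ℕ)
  (a-sym : ∀ u v → a u v ≡ a v u)
  (deg≤n : ∀ u → sum (a u) ≤ n)
  (walks : ∀ u → sum (λ w → sum (λ v → a u v * a v w)) ≤ sum (b u) * sum (a u) + K * n)
  where
  open ≤-Reasoning

  private
    -- The shift by T keeps x positive and bounds w u = P / x u by P / T; the factorial
    -- clears the denominators of the weights 1 / x u.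
    d x w : Fin n → ℕ
    P : ℕ
    d u = sum (a u)
    x u = d u + T
    P = (n + T) !

    instance
      x≢0 : ∀ {u} → NonZero (x u)
      x≢0 {u} = >-nonZero (≤-trans (>-nonZero⁻¹ T) (m≤n+m T (d u)))

    x∣P : ∀ u → x u ∣ P
    x∣P u = ∣-! {x u} (+-monoˡ-≤ T (deg≤n u))
    w u = _∣_.quotient (x∣P u)

    P≡xw : ∀ u → P ≡ x u * w u
    P≡xw u = trans (_∣_.equality (x∣P u)) (*-comm (w u) (x u))

    dw≤P : ∀ u → d u * w u ≤ P
    dw≤P u = ≤-trans (*-monoˡ-≤ (w u) (m≤m+n (d u) T)) (≤-reflexive (sym (P≡xw u)))

    Tw≤P : ∀ u → T * w u ≤ P
    Tw≤P u = ≤-trans (*-monoˡ-≤ (w u) (m≤n+m T (d u))) (≤-reflexive (sym (P≡xw u)))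

    neighbours : ∀ u → sum (λ v → a u v * x v) ≤ sum (b u) * d u + K * n + d u * T
    neighbours u = begin
      sum (λ v → a u v * x v)
        ≡⟨ sum-cong-≗ (λ v → *-distribˡ-+ (a u v) (d v) T) ⟩
      sum (λ v → a u v * d v + a u v * T)
        ≡⟨ ∑-distrib-+ (λ v → a u v * d v) _ ⟩
      sum (λ v → a u v * d v) + sum (λ v → a u v * T)
        ≡⟨ cong₂ _+_ (sum-cong-≗ (λ v → *-distribˡ-sum (a u v) (a v))) (sym (*-distribʳ-sum T (a u))) ⟩
      sum (λ v → sum (λ w → a u v * a v w)) + d u * T
        ≡⟨ cong (_+ d u * T) (∑-comm (λ v w → a u v * a v w)) ⟩
      sum (λ w → sum (λ v → a u v * a v w)) + d u * T
        ≤⟨ +-monoˡ-≤ (d u * T) (walks u) ⟩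
      sum (b u) * d u + K * n + d u * T ∎

    -- This is `neighbours` divided by x u. The terms containing d u lose that factor because d u ≤
    -- x u, and K n is divided by T because T ≤ x u. The factor T on the left clears the fraction K
    -- n / T.
    row : ∀ u → T * sum (λ v → a u v * (x v * w u)) ≤ (T * sum (b u) + (K * n + T * T)) * P
    row u = begin
      T * sum (λ v → a u v * (x v * w u))
        ≡⟨ cong (T *_) (trans (sum-cong-≗ (λ v → sym (*-assoc (a u v) (x v) (w u)))) (sym (*-distribʳ-sum (w u) (λ v → a u v * x v)))) ⟩
      T * (sum (λ v → a u v * x v) * w u)
        ≤⟨ *-monoʳ-≤ T (*-monoˡ-≤ (w u) (neighbours u)) ⟩
      T * ((sum (b u) * d u + K * n + d u * T) * w u)
        ≡⟨ rearrange T (sum (b u)) (d u) (K * n) (w u) ⟩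
      (T * sum (b u) + T * T) * (d u * w u) + K * n * (T * w u)
        ≤⟨ +-mono-≤ (*-monoʳ-≤ (T * sum (b u) + T * T) (dw≤P u)) (*-monoʳ-≤ (K * n) (Tw≤P u)) ⟩
      (T * sum (b u) + T * T) * P + K * n * P
        ≡⟨ collect (T * sum (b u)) (T * T) (K * n) P ⟩
      (T * sum (b u) + (K * n + T * T)) * P ∎
      where
      rearrange : ∀ T s d k w → T * ((s * d + k + d * T) * w) ≡ (T * s + T * T) * (d * w) + k * (T * w)
      rearrange = solve-∀
      collect : ∀ s t k P → (s + t) * P + k * P ≡ (s + (k + t)) * P
      collect = solve-∀

    weighted : ℕ
    weighted = sum (λ u → sum (λ v → a u v * (x v * w u)))

    weighted-transpose : weighted ≡ sum (λ u → sum (λ v → a u v * (x u * w v)))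
    weighted-transpose = trans (∑-comm (λ u v → a u v * (x v * w u)))
      (sum-cong-≗ (λ u → sum-cong-≗ (λ v → cong (_* (x u * w v)) (a-sym v u))))

    -- Summing `am-gm` over ordered pairs produces `weighted` and its transpose. They agree by the
    -- symmetry of a, so the factor 2 cancels.
    edges≤weighted : sum (λ u → sum (a u)) * P ≤ weighted
    edges≤weighted = *-cancelˡ-≤ 2 (begin
      2 * (sum (λ u → sum (a u)) * P)
        ≡⟨ flip (sum (λ u → sum (a u))) P ⟩
      sum (λ u → sum (a u)) * (2 * P)
        ≡⟨ trans (*-distribʳ-sum (2 * P) (λ u → sum (a u))) (sum-cong-≗ (λ u → *-distribʳ-sum (2 * P) (a u))) ⟩
      sum (λ u → sum (λ v → a u v * (2 * P)))
        ≤⟨ sum-mono (λ u → sum-mono (λ v → *-monoʳ-≤ (a u v) (am-gm (x u) (w u) (x v) (w v) (P≡xw u) (P≡xw v)))) ⟩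
      sum (λ u → sum (λ v → a u v * (x v * w u + x u * w v)))
        ≡⟨ sum-cong-≗ (λ u → trans (sum-cong-≗ (λ v → *-distribˡ-+ (a u v) (x v * w u) (x u * w v))) (∑-distrib-+ (λ v → a u v * (x v * w u)) _)) ⟩
      sum (λ u → sum (λ v → a u v * (x v * w u)) + sum (λ v → a u v * (x u * w v)))
        ≡⟨ ∑-distrib-+ (λ u → sum (λ v → a u v * (x v * w u))) _ ⟩
      weighted + sum (λ u → sum (λ v → a u v * (x u * w v)))
        ≡⟨ cong (weighted +_) (trans (sym weighted-transpose) (sym (+-identityʳ weighted))) ⟩
      2 * weighted ∎)
      where
      flip : ∀ s P → 2 * (s * P) ≡ s * (2 * P)
      flip = solve-∀

  degree-sum-bound : T * sum (λ u → sum (a u)) ≤ T * sum (λ u → sum (b u)) + n * (K * n + T * T)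
  degree-sum-bound = *-cancelʳ-≤ _ _ P {{n!≢0}} (begin
    T * sum (λ u → sum (a u)) * P
      ≡⟨ *-assoc T _ P ⟩
    T * (sum (λ u → sum (a u)) * P)
      ≤⟨ *-monoʳ-≤ T edges≤weighted ⟩
    T * weighted
      ≡⟨ *-distribˡ-sum T (λ u → sum (λ v → a u v * (x v * w u))) ⟩
    sum (λ u → T * sum (λ v → a u v * (x v * w u)))
      ≤⟨ sum-mono row ⟩
    sum (λ u → (T * sum (b u) + (K * n + T * T)) * P)
      ≡⟨ sym (*-distribʳ-sum P (λ u → T * sum (b u) + (K * n + T * T))) ⟩
    sum (λ u → T * sum (b u) + (K * n + T * T)) * P
      ≡⟨ cong (_* P) (trans (∑-distrib-+ (λ u → T * sum (b u)) _)
           (cong₂ _+_ (sym (*-distribˡ-sum T (λ u → sum (b u)))) (sum-const n _))) ⟩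
    (T * sum (λ u → sum (b u)) + n * (K * n + T * T)) * P ∎)
    where
    n!≢0 = (n + T) !≢0

-- Counting edges by size

⟦_⟧ : Bool → ℕ
⟦ b ⟧ = if b then 1 else 0

⟦⟧≤1 : ∀ b → ⟦ b ⟧ ≤ 1
⟦⟧≤1 true  = ≤-refl
⟦⟧≤1 false = z≤n

⟦⟧-split : ∀ a b → ⟦ b ⟧ ≤ ⟦ a ⟧ + ⟦ not a ∧ b ⟧
⟦⟧-split false b     = ≤-refl
⟦⟧-split true  true  = ≤-refl
⟦⟧-split true  false = z≤n

count : ∀ {A : Set} → (A → Bool) → List A → ℕ
count p []       = 0
count p (x ∷ xs) = ⟦ p x ⟧ + count p xs

count-++ : ∀ {A : Set} (p : A → Bool) xs ys → count p (xs ++ ys) ≡ count p xs + count p ys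
count-++ p []       ys = refl
count-++ p (x ∷ xs) ys = trans (cong (⟦ p x ⟧ +_) (count-++ p xs ys)) (sym (+-assoc ⟦ p x ⟧ _ _))

count-map : ∀ {A B : Set} (p : B → Bool) (f : A → B) xs → count p (map f xs) ≡ count (p ∘ f) xs
count-map p f []       = refl
count-map p f (x ∷ xs) = cong (⟦ p (f x) ⟧ +_) (count-map p f xs)

count-false : ∀ {A : Set} (xs : List A) → count (λ _ → false) xs ≡ 0
count-false []       = refl
count-false (x ∷ xs) = count-false xs

onLevel : ∀ {n} → ℕ → Hypergraph n → Hypergraph n
onLevel k G F = (∣ F ∣ ≡ᵇ k) ∧ G F

countLevel : ∀ {n} → ℕ → Hypergraph n → ℕ
countLevel {n} k G = count (onLevel k G) (allSubsets n)

count-allSubsets : ∀ {n} (G : Hypergraph (suc n)) → count G (allSubsets (suc n))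
  ≡ count (G ∘ (true ∷_)) (allSubsets n) + count (G ∘ (false ∷_)) (allSubsets n)
count-allSubsets {n} G = trans (count-++ G (map (true ∷_) (allSubsets n)) _)
  (cong₂ _+_ (count-map G _ (allSubsets n)) (count-map G _ (allSubsets n)))

countLevel-0 : ∀ n (G : Hypergraph n) → countLevel 0 G ≡ ⟦ G ⊥ ⟧
countLevel-0 zero    G = +-identityʳ _
countLevel-0 (suc n) G = trans (count-allSubsets (onLevel 0 G))
  (cong₂ _+_ (count-false (allSubsets n)) (countLevel-0 n (G ∘ (false ∷_))))

countLevel-1 : ∀ n (G : Hypergraph n) → countLevel 1 G ≡ sum (λ u → ⟦ G ⁅ u ⁆ ⟧)
countLevel-1 zero    G = refl
countLevel-1 (suc n) G = trans (count-allSubsets (onLevel 1 G))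
  (cong₂ _+_ (countLevel-0 n (G ∘ (true ∷_))) (countLevel-1 n (G ∘ (false ∷_))))

-- For u = w the union is a singleton, which the level test rejects, so the adjacency matrix has
-- zero diagonal.
adj : ∀ {n} → Hypergraph n → Fin n → Fin n → Bool
adj G u w = onLevel 2 G (⁅ u ⁆ ∪ ⁅ w ⁆)

-- Handshake lemma by removing vertex zero: the edges at that vertex form both its row and its
-- column of the adjacency matrix, and the remaining edges are covered by induction.
countLevel-2 : ∀ n (G : Hypergraph n) → 2 * countLevel 2 G ≡ sum (λ u → sum (λ w → ⟦ adj G u w ⟧))
countLevel-2 zero    G = refl
countLevel-2 (suc n) G = begin
  2 * countLevel 2 G
    ≡⟨ cong (2 *_) (count-allSubsets (onLevel 2 G)) ⟩
  2 * (countLevel 1 (G ∘ (true ∷_)) + countLevel 2 (G ∘ (false ∷_)))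
    ≡⟨ double (countLevel 1 (G ∘ (true ∷_))) _ ⟩
  countLevel 1 (G ∘ (true ∷_)) + (countLevel 1 (G ∘ (true ∷_)) + 2 * countLevel 2 (G ∘ (false ∷_)))
    ≡⟨ cong₂ (λ x y → x + (x + y)) (countLevel-1 n (G ∘ (true ∷_))) (countLevel-2 n (G ∘ (false ∷_))) ⟩
  star + (star + sum (λ u → sum (λ w → ⟦ adj (G ∘ (false ∷_)) u w ⟧)))
    ≡⟨ cong₂ (λ x y → x + (y + sum (λ u → sum (λ w → ⟦ adj G (suc u) (suc w) ⟧)))) (sym star-out) (sym star-in) ⟩
  sum (λ w → ⟦ adj G zero w ⟧) + (sum (λ u → ⟦ adj G (suc u) zero ⟧) + sum (λ u → sum (λ w → ⟦ adj G (suc u) (suc w) ⟧)))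
    ≡⟨ cong (sum (λ w → ⟦ adj G zero w ⟧) +_) (sym (∑-distrib-+ (λ u → ⟦ adj G (suc u) zero ⟧) _)) ⟩
  sum (λ u → sum (λ w → ⟦ adj G u w ⟧)) ∎
  where
  open ≡-Reasoning
  star = sum (λ u → ⟦ G (true ∷ ⁅ u ⁆) ⟧)
  double : ∀ x y → 2 * (x + y) ≡ x + (x + 2 * y)
  double = solve-∀
  at : ∀ {F} u → F ≡ ⁅ u ⁆ → ⟦ onLevel 2 G (true ∷ F) ⟧ ≡ ⟦ G (true ∷ ⁅ u ⁆) ⟧
  at u refl = cong (λ k → ⟦ (k ≡ᵇ 1) ∧ G (true ∷ ⁅ u ⁆) ⟧) (∣⁅x⁆∣≡1 u)
  no-loop : ⟦ adj G zero zero ⟧ ≡ 0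
  no-loop = cong (λ k → ⟦ (k ≡ᵇ 1) ∧ G (true ∷ (⊥ ∪ ⊥)) ⟧) (trans (cong ∣_∣ (∪-identityˡ (⊥ {n}))) (∣⊥∣≡0 n))
  star-out : sum (λ w → ⟦ adj G zero w ⟧) ≡ star
  star-out = cong₂ _+_ no-loop (sum-cong-≗ (λ w → at w (∪-identityˡ ⁅ w ⁆)))
  star-in : sum (λ u → ⟦ adj G (suc u) zero ⟧) ≡ star
  star-in = sum-cong-≗ (λ u → at u (∪-identityʳ ⁅ u ⁆))

countLevel-complete : ∀ n k → countLevel {n} k (λ _ → true) ≡ n C k
countLevel-complete zero    zero    = refl
countLevel-complete zero    (suc k) = refl
countLevel-complete (suc n) zero    = countLevel-0 (suc n) (λ _ → true)
countLevel-complete (suc n) (suc k) = trans (count-allSubsets {n} (onLevel (suc k) (λ _ → true)))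
  (trans (cong₂ _+_ (countLevel-complete n k) (countLevel-complete n (suc k))) (nCk+nC[k+1]≡[n+1]C[k+1] n k))

2*nC2+n≡n*n : ∀ n → 2 * (n C 2) + n ≡ n * n
2*nC2+n≡n*n zero    = refl
2*nC2+n≡n*n (suc n) = begin
  2 * (suc n C 2) + suc n        ≡⟨ cong (λ c → 2 * c + suc n) (trans (sym (nCk+nC[k+1]≡[n+1]C[k+1] n 1)) (cong (_+ n C 2) (nC1≡n n))) ⟩
  2 * (n + n C 2) + suc n        ≡⟨ expand n (n C 2) ⟩
  2 * n + 1 + (2 * (n C 2) + n)  ≡⟨ cong (2 * n + 1 +_) (2*nC2+n≡n*n n) ⟩
  2 * n + 1 + n * n              ≡⟨ square n ⟩
  suc n * suc n                  ∎
  where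
  open ≡-Reasoning
  expand : ∀ n c → 2 * (n + c) + suc n ≡ 2 * n + 1 + (2 * c + n)
  expand = solve-∀
  square : ∀ n → 2 * n + 1 + n * n ≡ suc n * suc n
  square = solve-∀

-- Lubell functions

ι : ℕ → ℚ
ι n = ℤ.+ n / 1

ι-+ : ∀ a b → ι (a + b) ≡ ι a ℚ.+ ι b
ι-+ a b = ℚₚ.toℚᵘ-injective (begin
  ℚ.toℚᵘ (ι (a + b))              ≈⟨ ℚₚ.toℚᵘ-fromℚᵘ (mkℚᵘ (ℤ.+ (a + b)) 0) ⟩
  mkℚᵘ (ℤ.+ (a + b)) 0              ≈⟨ *≡* (cong (ℤ._* (ℤ.+ 1)) (cong₂ ℤ._+_ (sym (ℤₚ.*-identityʳ (ℤ.+ a))) (sym (ℤₚ.*-identityʳ (ℤ.+ b))))) ⟩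
  mkℚᵘ (ℤ.+ a) 0 ℚᵘ.+ mkℚᵘ (ℤ.+ b) 0  ≈⟨ ℚᵘₚ.+-cong (ℚₚ.toℚᵘ-fromℚᵘ (mkℚᵘ (ℤ.+ a) 0)) (ℚₚ.toℚᵘ-fromℚᵘ (mkℚᵘ (ℤ.+ b) 0)) ⟨
  ℚ.toℚᵘ (ι a) ℚᵘ.+ ℚ.toℚᵘ (ι b)  ≈⟨ ℚₚ.toℚᵘ-homo-+ (ι a) (ι b) ⟨
  ℚ.toℚᵘ (ι a ℚ.+ ι b)            ∎)
  where open ℚᵘₚ.≃-Reasoning

ι-* : ∀ a b → ι (a * b) ≡ ι a ℚ.* ι b
ι-* zero    b = sym (ℚₚ.*-zeroˡ (ι b))
ι-* (suc a) b = begin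
  ι (b + a * b)                    ≡⟨ ι-+ b (a * b) ⟩
  ι b ℚ.+ ι (a * b)                ≡⟨ cong₂ ℚ._+_ (sym (ℚₚ.*-identityˡ (ι b))) (ι-* a b) ⟩
  1ℚ ℚ.* ι b ℚ.+ ι a ℚ.* ι b       ≡⟨ ℚₚ.*-distribʳ-+ (ι b) 1ℚ (ι a) ⟨
  (1ℚ ℚ.+ ι a) ℚ.* ι b             ≡⟨ cong (ℚ._* ι b) (ι-+ 1 a) ⟨
  ι (suc a) ℚ.* ι b                ∎
  where open ≡-Reasoning

ι-nonNeg : ∀ n → ℚ.NonNegative (ι n)
ι-nonNeg n = ℚₚ.normalize-nonNeg n 1

ι-mono : ∀ {a b} → a ≤ b → ι a ℚ.≤ ι b
ι-mono {a} {b} a≤b = subst₂ ℚ._≤_ (ℚₚ.+-identityʳ (ι a)) (trans (sym (ι-+ a (b ∸ a))) (cong ι (m+[n∸m]≡n a≤b)))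
  (ℚₚ.+-monoʳ-≤ (ι a) (ℚₚ.nonNegative⁻¹ (ι (b ∸ a)) {{ι-nonNeg (b ∸ a)}}))

inv-nonNeg : ∀ n → ℚ.NonNegative (inv n)
inv-nonNeg zero    = _
inv-nonNeg (suc n) = ℚₚ.normalize-nonNeg 1 (suc n)

ι*inv : ∀ n → .{{NonZero n}} → ι n ℚ.* inv n ≡ 1ℚ
ι*inv (suc n) = ℚₚ.toℚᵘ-injective (begin
  ℚ.toℚᵘ (ι (suc n) ℚ.* inv (suc n))            ≈⟨ ℚₚ.toℚᵘ-homo-* (ι (suc n)) (inv (suc n)) ⟩
  ℚ.toℚᵘ (ι (suc n)) ℚᵘ.* ℚ.toℚᵘ (inv (suc n))  ≈⟨ ℚᵘₚ.*-cong (ℚₚ.toℚᵘ-fromℚᵘ (mkℚᵘ (ℤ.+ suc n) 0)) (ℚₚ.toℚᵘ-fromℚᵘ (mkℚᵘ (ℤ.+ 1) n)) ⟩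
  mkℚᵘ (ℤ.+ suc n) 0 ℚᵘ.* mkℚᵘ (ℤ.+ 1) n            ≈⟨ *≡* (cong ℤ.+_ (trans (cong (_* 1) (*-comm (suc n) 1)) (trans (*-identityʳ _) (sym (*-identityˡ _))))) ⟩
  mkℚᵘ (ℤ.+ 1) 0                                  ∎)
  where open ℚᵘₚ.≃-Reasoning

-- Division by m D turns counts into densities and the slack D into 1/m.
scale-down : ∀ m D a b → .{{NonZero m}} → .{{NonZero D}} → m * a ≤ m * b + D →
  ι a ℚ.* inv D ℚ.≤ ι b ℚ.* inv D ℚ.+ inv m
scale-down m D a b ma≤mb+D = begin
  ι a ℚ.* c                          ≡⟨ unscale a ⟨
  ι (m * a) ℚ.* (c ℚ.* inv m)        ≤⟨ ℚₚ.*-monoʳ-≤-nonNeg (c ℚ.* inv m) {{ℚₚ.nonNeg*nonNeg⇒nonNeg c {{inv-nonNeg D}} (inv m) {{inv-nonNeg m}}}} (ι-mono ma≤mb+D) ⟩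
  ι (m * b + D) ℚ.* (c ℚ.* inv m)    ≡⟨ cong (ℚ._* (c ℚ.* inv m)) (ι-+ (m * b) D) ⟩
  (ι (m * b) ℚ.+ ι D) ℚ.* (c ℚ.* inv m) ≡⟨ ℚₚ.*-distribʳ-+ (c ℚ.* inv m) (ι (m * b)) (ι D) ⟩
  ι (m * b) ℚ.* (c ℚ.* inv m) ℚ.+ ι D ℚ.* (c ℚ.* inv m)
    ≡⟨ cong₂ ℚ._+_ (unscale b) (trans (sym (ℚₚ.*-assoc (ι D) c (inv m))) (trans (cong (ℚ._* inv m) (ι*inv D)) (ℚₚ.*-identityˡ (inv m)))) ⟩
  ι b ℚ.* c ℚ.+ inv m                ∎
  where
  open ℚₚ.≤-Reasoning
  c = inv D
  unscale : ∀ x → ι (m * x) ℚ.* (c ℚ.* inv m) ≡ ι x ℚ.* c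
  unscale x = ≡R.begin
    ι (m * x) ℚ.* (c ℚ.* inv m)             ≡R.≡⟨ cong₂ ℚ._*_ (trans (cong ι (*-comm m x)) (ι-* x m)) (ℚₚ.*-comm c (inv m)) ⟩
    (ι x ℚ.* ι m) ℚ.* (inv m ℚ.* c)         ≡R.≡⟨ ℚₚ.*-assoc (ι x) (ι m) (inv m ℚ.* c) ⟩
    ι x ℚ.* (ι m ℚ.* (inv m ℚ.* c))         ≡R.≡⟨ cong (ι x ℚ.*_) (trans (sym (ℚₚ.*-assoc (ι m) (inv m) c)) (trans (cong (ℚ._* c) (ι*inv m)) (ℚₚ.*-identityˡ c))) ⟩
    ι x ℚ.* c                               ≡R.∎
    where module ≡R = ≡-Reasoning

-- The fold inside `h`, over an arbitrary list, so that induction is possible; `h G` is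
-- `weightSum G (allSubsets n)` by definition.
weightSum : ∀ {n} → Hypergraph n → List (Subset n) → ℚ
weightSum {n} G = foldr (λ F acc → (if G F then inv (n C ∣ F ∣) else 0ℚ) ℚ.+ acc) 0ℚ

weightSum-cong : ∀ {n} {G G' : Hypergraph n} → (∀ F → G F ≡ G' F) → ∀ xs → weightSum G xs ≡ weightSum G' xs
weightSum-cong         G≗G' []       = refl
weightSum-cong {n} G≗G' (F ∷ xs) =
  cong₂ ℚ._+_ (cong (if_then inv (n C ∣ F ∣) else 0ℚ) (G≗G' F)) (weightSum-cong G≗G' xs)

ι⟦⟧* : ∀ b c → ι ⟦ b ⟧ ℚ.* c ≡ (if b then c else 0ℚ)
ι⟦⟧* true  c = ℚₚ.*-identityˡ c
ι⟦⟧* false c = ℚₚ.*-zeroˡ c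

≡ᵇ-reflects-≢ : ∀ m k → (m ≡ᵇ k) ≡ false → ¬ m ≡ k
≡ᵇ-reflects-≢ m k eq m≡k = subst T eq (≡⇒≡ᵇ m k m≡k)

≡ᵇ-reflects-≡ : ∀ m k → (m ≡ᵇ k) ≡ true → m ≡ k
≡ᵇ-reflects-≡ m k eq = ≡ᵇ⇒≡ m k (subst T (sym eq) _)

-- All sets of size k have the same weight, so exchanging level k changes the sum by the difference
-- of the counts times that weight. Each side carries the count of the other hypergraph, which makes
-- the identity provable term by term without subtraction.
weightSum-swap : ∀ {n} k (G G' : Hypergraph n) → (∀ F → ¬ ∣ F ∣ ≡ k → G F ≡ G' F) → ∀ xs →
  weightSum G xs ℚ.+ ι (count (onLevel k G') xs) ℚ.* inv (n C k) ≡
  weightSum G' xs ℚ.+ ι (count (onLevel k G) xs) ℚ.* inv (n C k)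
weightSum-swap         k G G' agree []       = refl
weightSum-swap {n} k G G' agree (F ∷ xs) = begin
  (term G ℚ.+ weightSum G xs) ℚ.+ ι (⟦ onLevel k G' F ⟧ + count (onLevel k G') xs) ℚ.* c
    ≡⟨ split (term G) (weightSum G xs) (onLevel k G' F) (count (onLevel k G') xs) ⟩
  (term G ℚ.+ ι ⟦ onLevel k G' F ⟧ ℚ.* c) ℚ.+ (weightSum G xs ℚ.+ ι (count (onLevel k G') xs) ℚ.* c)
    ≡⟨ cong₂ ℚ._+_ step (weightSum-swap k G G' agree xs) ⟩
  (term G' ℚ.+ ι ⟦ onLevel k G F ⟧ ℚ.* c) ℚ.+ (weightSum G' xs ℚ.+ ι (count (onLevel k G) xs) ℚ.* c)
    ≡⟨ split (term G') (weightSum G' xs) (onLevel k G F) (count (onLevel k G) xs) ⟨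
  (term G' ℚ.+ weightSum G' xs) ℚ.+ ι (⟦ onLevel k G F ⟧ + count (onLevel k G) xs) ℚ.* c ∎
  where
  open ≡-Reasoning
  c = inv (n C k)
  term : Hypergraph n → ℚ
  term G = if G F then inv (n C ∣ F ∣) else 0ℚ
  split : ∀ t s b m → (t ℚ.+ s) ℚ.+ ι (⟦ b ⟧ + m) ℚ.* c ≡ (t ℚ.+ ι ⟦ b ⟧ ℚ.* c) ℚ.+ (s ℚ.+ ι m ℚ.* c)
  split t s b m = trans (cong (λ x → (t ℚ.+ s) ℚ.+ x ℚ.* c) (ι-+ ⟦ b ⟧ m))
    (solve 5 (λ t s x y c → (t :+ s) :+ (x :+ y) :* c := (t :+ x :* c) :+ (s :+ y :* c)) refl t s (ι ⟦ b ⟧) (ι m) c)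
  step : term G ℚ.+ ι ⟦ onLevel k G' F ⟧ ℚ.* c ≡ term G' ℚ.+ ι ⟦ onLevel k G F ⟧ ℚ.* c
  step with ∣ F ∣ ≡ᵇ k in eq
  ... | true  rewrite ≡ᵇ-reflects-≡ ∣ F ∣ k eq =
    trans (cong (term-k G ℚ.+_) (ι⟦⟧* (G' F) c)) (trans (ℚₚ.+-comm (term-k G) (term-k G')) (cong (term-k G' ℚ.+_) (sym (ι⟦⟧* (G F) c))))
    where
    term-k : Hypergraph n → ℚ
    term-k G = if G F then c else 0ℚ
  ... | false = cong (λ b → (if b then inv (n C ∣ F ∣) else 0ℚ) ℚ.+ ι 0 ℚ.* c) (agree F (≡ᵇ-reflects-≢ ∣ F ∣ k eq))

h-swap : ∀ {n} k (G G' : Hypergraph n) → (∀ F → ¬ ∣ F ∣ ≡ k → G F ≡ G' F) →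
  h G ℚ.+ ι (countLevel k G') ℚ.* inv (n C k) ≡ h G' ℚ.+ ι (countLevel k G) ℚ.* inv (n C k)
h-swap {n} k G G' agree = weightSum-swap k G G' agree (allSubsets n)

h-cong : ∀ {n} {G G' : Hypergraph n} → (∀ F → G F ≡ G' F) → h G ≡ h G'
h-cong {n} G≗G' = weightSum-cong G≗G' (allSubsets n)

h-nonNeg : ∀ {n} (G : Hypergraph n) → 0ℚ ℚ.≤ h G
h-nonNeg {n} G = go (allSubsets n)
  where
  term-nonNeg : ∀ b k → 0ℚ ℚ.≤ (if b then inv k else 0ℚ)
  term-nonNeg true  k = ℚₚ.nonNegative⁻¹ (inv k) {{inv-nonNeg k}}
  term-nonNeg false k = ℚₚ.≤-refl
  go : ∀ xs → 0ℚ ℚ.≤ weightSum G xs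
  go []       = ℚₚ.≤-refl
  go (F ∷ xs) = ℚₚ.+-mono-≤ (term-nonNeg (G F) (n C ∣ F ∣)) (go xs)

h-level-bound : ∀ {n} m (G G' : Hypergraph n) → .{{NonZero m}} → .{{NonZero (n C 2)}} →
  (∀ F → ¬ ∣ F ∣ ≡ 2 → G F ≡ G' F) → m * countLevel 2 G ≤ m * countLevel 2 G' + n C 2 → h G ℚ.≤ h G' ℚ.+ inv m
h-level-bound {n} m G G' agree bound = ≤-from-+ (begin
  h G ℚ.+ e'                ≡⟨ h-swap 2 G G' agree ⟩
  h G' ℚ.+ ι (countLevel 2 G) ℚ.* inv (n C 2) ≤⟨ ℚₚ.+-monoʳ-≤ (h G') (scale-down m (n C 2) _ (countLevel 2 G') bound) ⟩
  h G' ℚ.+ (e' ℚ.+ inv m)   ≡⟨ solve 3 (λ x y z → x :+ (y :+ z) := (x :+ z) :+ y) refl (h G') e' (inv m) ⟩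
  (h G' ℚ.+ inv m) ℚ.+ e'   ∎)
  where
  open ℚₚ.≤-Reasoning
  e' = ι (countLevel 2 G') ℚ.* inv (n C 2)
  ≤-from-+ : ∀ {p q} → p ℚ.+ e' ℚ.≤ q ℚ.+ e' → p ℚ.≤ q
  ≤-from-+ {p} {q} le = subst₂ ℚ._≤_ (cancel p) (cancel q) (ℚₚ.+-monoˡ-≤ (ℚ.- e') le)
    where
    cancel : ∀ p → (p ℚ.+ e') ℚ.+ ℚ.- e' ≡ p
    cancel p = trans (ℚₚ.+-assoc p e' (ℚ.- e')) (trans (cong (p ℚ.+_) (ℚₚ.+-inverseʳ e')) (ℚₚ.+-identityʳ p))

-- Hypergraphs made of complete levels

levels : ∀ n → (ℕ → Bool) → Hypergraph n
levels n p F = p ∣ F ∣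

C-nonZero : ∀ {n k} → k ≤ n → NonZero (n C k)
C-nonZero {n}     {zero}  z≤n       = _
C-nonZero {suc n} {suc k} (s≤s k≤n) = subst NonZero (nCk+nC[k+1]≡[n+1]C[k+1] n k) (m+n≢0 (n C k) {{C-nonZero k≤n}})
  where
  m+n≢0 : ∀ m {o} → .{{NonZero m}} → NonZero (m + o)
  m+n≢0 (suc m) = _

remove : ℕ → (ℕ → Bool) → ℕ → Bool
remove k p i = not (i ≡ᵇ k) ∧ p i

count-cong : ∀ {A : Set} {p q : A → Bool} → (∀ x → p x ≡ q x) → ∀ xs → count p xs ≡ count q xs
count-cong p≗q []       = refl
count-cong p≗q (x ∷ xs) = cong₂ _+_ (cong ⟦_⟧ (p≗q x)) (count-cong p≗q xs)

-- A complete level consists of `n C k` sets of weight 1/(`n C k`), total 1; `k ≤ n` keeps the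
-- binomial coefficient positive.
h-levels-remove : ∀ {n} k p → k ≤ n → p k ≡ true → h (levels n p) ≡ h (levels n (remove k p)) ℚ.+ 1ℚ
h-levels-remove {n} k p k≤n pk = begin
  h (levels n p)
    ≡⟨ ℚₚ.+-identityʳ _ ⟨
  h (levels n p) ℚ.+ 0ℚ
    ≡⟨ cong (h (levels n p) ℚ.+_) (trans (cong (λ e → ι e ℚ.* inv (n C k)) none) (ℚₚ.*-zeroˡ (inv (n C k)))) ⟨
  h (levels n p) ℚ.+ ι (countLevel k (levels n (remove k p))) ℚ.* inv (n C k)
    ≡⟨ h-swap k (levels n p) (levels n (remove k p)) agree ⟩
  h (levels n (remove k p)) ℚ.+ ι (countLevel k (levels n p)) ℚ.* inv (n C k)
    ≡⟨ cong (h (levels n (remove k p)) ℚ.+_) (trans (cong (λ e → ι e ℚ.* inv (n C k)) all) (ι*inv (n C k) {{C-nonZero k≤n}})) ⟩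
  h (levels n (remove k p)) ℚ.+ 1ℚ ∎
  where
  open ≡-Reasoning
  agree : ∀ F → ¬ ∣ F ∣ ≡ k → p ∣ F ∣ ≡ remove k p ∣ F ∣
  agree F ≢k with ∣ F ∣ ≡ᵇ k in eq
  ... | true  = contradiction (≡ᵇ-reflects-≡ ∣ F ∣ k eq) ≢k
  ... | false = refl
  none : countLevel k (levels n (remove k p)) ≡ 0
  none = trans (count-cong (λ F → helper (∣ F ∣ ≡ᵇ k) (p ∣ F ∣)) (allSubsets n)) (count-false (allSubsets n))
    where
    helper : ∀ a b → a ∧ (not a ∧ b) ≡ false
    helper true  b = refl
    helper false b = refl
  all : countLevel k (levels n p) ≡ n C k
  all = trans (count-cong helper (allSubsets n)) (countLevel-complete n k)
    where
    helper : ∀ F → (∣ F ∣ ≡ᵇ k) ∧ p ∣ F ∣ ≡ (∣ F ∣ ≡ᵇ k) ∧ true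
    helper F with ∣ F ∣ ≡ᵇ k in eq
    ... | true  = trans (cong p (≡ᵇ-reflects-≡ ∣ F ∣ k eq)) pk
    ... | false = refl

countUpTo-cong : ∀ {p q} m → (∀ i → i ≤ m → p i ≡ q i) → countUpTo p m ≡ countUpTo q m
countUpTo-cong zero    p≗q = cong ⟦_⟧ (p≗q 0 z≤n)
countUpTo-cong (suc m) p≗q = cong₂ _+_ (cong ⟦_⟧ (p≗q (suc m) ≤-refl)) (countUpTo-cong m (λ i i≤m → p≗q i (m≤n⇒m≤1+n i≤m)))

-- Complete levels are peeled off from size m downwards, each for a weight of 1, so that the sizes
-- still to be counted are unaffected. Whatever is left at the end has nonnegative weight.
h-levels : ∀ {n} m p → m ≤ n → ι (countUpTo p m) ℚ.≤ h (levels n p)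
h-levels {n} zero p m≤n with p 0 in p0
... | true  = subst (1ℚ ℚ.≤_) (sym (h-levels-remove 0 p m≤n p0)) (ℚₚ.+-monoˡ-≤ 1ℚ (h-nonNeg (levels n (remove 0 p))))
... | false = h-nonNeg (levels n p)
h-levels {n} (suc m) p m≤n with p (suc m) in psm
... | false = h-levels m p (<⇒≤ m≤n)
... | true  = begin
  ι (1 + countUpTo p m)                        ≡⟨ ι-+ 1 (countUpTo p m) ⟩
  1ℚ ℚ.+ ι (countUpTo p m)                     ≡⟨ ℚₚ.+-comm 1ℚ (ι (countUpTo p m)) ⟩
  ι (countUpTo p m) ℚ.+ 1ℚ                     ≡⟨ cong (λ c → ι c ℚ.+ 1ℚ) (countUpTo-cong m unaffected) ⟩
  ι (countUpTo (remove (suc m) p) m) ℚ.+ 1ℚ    ≤⟨ ℚₚ.+-monoˡ-≤ 1ℚ (h-levels m (remove (suc m) p) (<⇒≤ m≤n)) ⟩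
  h (levels n (remove (suc m) p)) ℚ.+ 1ℚ       ≡⟨ h-levels-remove (suc m) p m≤n psm ⟨
  h (levels n p)                               ∎
  where
  open ℚₚ.≤-Reasoning
  unaffected : ∀ i → i ≤ m → p i ≡ remove (suc m) p i
  unaffected i i≤m with i ≡ᵇ suc m in eq
  ... | true  = contradiction (subst (_≤ m) (≡ᵇ-reflects-≡ i (suc m) eq) i≤m) 1+n≰n
  ... | false = refl

-- Images and greedy extension of embeddings

⌊⌋-true⁻ : ∀ {P : Set} (P? : Dec P) → ⌊ P? ⌋ ≡ true → P
⌊⌋-true⁻ (yes p) _ = p

⌊⌋-true⁺ : ∀ {P : Set} (P? : Dec P) → P → ⌊ P? ⌋ ≡ true
⌊⌋-true⁺ (yes _) _ = refl
⌊⌋-true⁺ (no ¬p) p = contradiction p ¬p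

∧-true⁻ : ∀ {a b} → a ∧ b ≡ true → a ≡ true × b ≡ true
∧-true⁻ {true} eq = refl , eq

∧-true⁺ : ∀ {a b} → a ≡ true → b ≡ true → a ∧ b ≡ true
∧-true⁺ refl refl = refl

∨-true⁻ : ∀ {a b} → a ∨ b ≡ true → a ≡ true ⊎ b ≡ true
∨-true⁻ {true}  _  = inj₁ refl
∨-true⁻ {false} eq = inj₂ eq

∨-true⁺ʳ : ∀ {a b} → b ≡ true → a ∨ b ≡ true
∨-true⁺ʳ {a} refl = ∨-zeroʳ a

not-true⁻ : ∀ {b} → not b ≡ true → ¬ b ≡ true
not-true⁻ {false} _ ()

not-true⁺ : ∀ {b} → ¬ b ≡ true → not b ≡ true
not-true⁺ {true}  b≢true = contradiction refl b≢true
not-true⁺ {false} _      = refl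

anyFin-true⁻ : ∀ {n} (p : Fin n → Bool) → anyFin p ≡ true → ∃ λ i → p i ≡ true
anyFin-true⁻ {suc n} p eq with ∨-true⁻ {p zero} eq
... | inj₁ p0 = zero , p0
... | inj₂ rest with anyFin-true⁻ (p ∘ suc) rest
...   | i , pi = suc i , pi

anyFin-true⁺ : ∀ {n} (p : Fin n → Bool) i → p i ≡ true → anyFin p ≡ true
anyFin-true⁺ p zero    pi rewrite pi = refl
anyFin-true⁺ p (suc i) pi = ∨-true⁺ʳ {p zero} (anyFin-true⁺ (p ∘ suc) i pi)

eqSub⇒≡ : ∀ {n} (F F' : Subset n) → eqSub F F' ≡ true → F ≡ F'
eqSub⇒≡ []          []           eq = refl
eqSub⇒≡ (true  ∷ F) (true  ∷ F') eq = cong (true ∷_) (eqSub⇒≡ F F' eq)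
eqSub⇒≡ (false ∷ F) (false ∷ F') eq = cong (false ∷_) (eqSub⇒≡ F F' eq)

eqSub-refl : ∀ {n} (F : Subset n) → eqSub F F ≡ true
eqSub-refl []          = refl
eqSub-refl (true  ∷ F) = eqSub-refl F
eqSub-refl (false ∷ F) = eqSub-refl F

Subset-ext : ∀ {n} {F F' : Subset n} → (∀ i → lookup F i ≡ lookup F' i) → F ≡ F'
Subset-ext {F = F} {F'} eq = trans (sym (tabulate∘lookup F)) (trans (tabulate-cong eq) (tabulate∘lookup F'))

lookup-⁅⁆ : ∀ {n} (u w : Fin n) → lookup ⁅ u ⁆ w ≡ ⌊ u ≟ w ⌋
lookup-⁅⁆ u w with u ≟ w
... | yes refl = diagonal u
  where
  diagonal : ∀ {n} (u : Fin n) → lookup ⁅ u ⁆ u ≡ true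
  diagonal zero    = refl
  diagonal (suc u) = diagonal u
... | no u≢w = off-diagonal u w u≢w
  where
  off-diagonal : ∀ {n} (u w : Fin n) → ¬ u ≡ w → lookup ⁅ u ⁆ w ≡ false
  off-diagonal zero    zero    u≢w = contradiction refl u≢w
  off-diagonal zero    (suc w) u≢w = lookup-replicate w false
  off-diagonal (suc u) zero    u≢w = refl
  off-diagonal (suc u) (suc w) u≢w = off-diagonal u w (u≢w ∘ cong suc)

lookup-⁅⁆-refl : ∀ {n} (u : Fin n) → lookup ⁅ u ⁆ u ≡ true
lookup-⁅⁆-refl u = trans (lookup-⁅⁆ u u) (⌊⌋-true⁺ (u ≟ u) refl)

lookup-⁅⁆⁻ : ∀ {n} (u w : Fin n) → lookup ⁅ u ⁆ w ≡ true → u ≡ w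
lookup-⁅⁆⁻ u w eq = ⌊⌋-true⁻ (u ≟ w) (trans (sym (lookup-⁅⁆ u w)) eq)

image-true∷ : ∀ {a b} (f : Fin (suc a) → Fin b) F → image f (true ∷ F) ≡ ⁅ f zero ⁆ ∪ image (f ∘ suc) F
image-true∷ f F = Subset-ext λ j → trans (lookup∘tabulate _ j) (sym (trans
  (lookup-zipWith _∨_ j ⁅ f zero ⁆ (image (f ∘ suc) F))
  (cong₂ _∨_ (lookup-⁅⁆ (f zero) j) (lookup∘tabulate _ j))))

image-⊥ : ∀ {a b} (f : Fin a → Fin b) → image f ⊥ ≡ ⊥
image-⊥ {zero}  f = Subset-ext (λ j → trans (lookup∘tabulate _ j) (sym (lookup-replicate j false)))
image-⊥ {suc a} f = image-⊥ (f ∘ suc)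

image-⁅⁆ : ∀ {a b} (f : Fin a → Fin b) u → image f ⁅ u ⁆ ≡ ⁅ f u ⁆
image-⁅⁆ f zero    = trans (image-true∷ f ⊥) (trans (cong (⁅ f zero ⁆ ∪_) (image-⊥ (f ∘ suc))) (∪-identityʳ ⁅ f zero ⁆))
image-⁅⁆ f (suc u) = image-⁅⁆ (f ∘ suc) u

∈-image⁺ : ∀ {a b} (f : Fin a → Fin b) F i → lookup F i ≡ true → lookup (image f F) (f i) ≡ true
∈-image⁺ f F i i∈F = trans (lookup∘tabulate _ (f i)) (anyFin-true⁺ _ i (∧-true⁺ i∈F (⌊⌋-true⁺ (f i ≟ f i) refl)))

∈-image⁻ : ∀ {a b} (f : Fin a → Fin b) F j → lookup (image f F) j ≡ true → ∃ λ i → lookup F i ≡ true × f i ≡ j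
∈-image⁻ f F j j∈ with anyFin-true⁻ (λ i → lookup F i ∧ ⌊ f i ≟ j ⌋) (trans (sym (lookup∘tabulate _ j)) j∈)
... | i , eq = i , proj₁ (∧-true⁻ eq) , ⌊⌋-true⁻ (f i ≟ j) (proj₂ (∧-true⁻ eq))

∣⁅x⁆∪p∣ : ∀ {n} (x : Fin n) p → ¬ lookup p x ≡ true → ∣ ⁅ x ⁆ ∪ p ∣ ≡ suc ∣ p ∣
∣⁅x⁆∪p∣ zero    (true  ∷ p) x∉p = contradiction refl x∉p
∣⁅x⁆∪p∣ zero    (false ∷ p) x∉p = cong (suc ∘ ∣_∣) (∪-identityˡ p)
∣⁅x⁆∪p∣ (suc x) (true  ∷ p) x∉p = cong suc (∣⁅x⁆∪p∣ x p x∉p)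
∣⁅x⁆∪p∣ (suc x) (false ∷ p) x∉p = ∣⁅x⁆∪p∣ x p x∉p

∣pair∣≡2 : ∀ {n} {u w : Fin n} → ¬ u ≡ w → ∣ ⁅ u ⁆ ∪ ⁅ w ⁆ ∣ ≡ 2
∣pair∣≡2 {u = u} {w} u≢w = trans (∣⁅x⁆∪p∣ u ⁅ w ⁆ (λ u∈ → u≢w (sym (lookup-⁅⁆⁻ w u u∈)))) (cong suc (∣⁅x⁆∣≡1 w))

∣image∣ : ∀ {a b} (f : Fin a → Fin b) → Injective _≡_ _≡_ f → ∀ F → ∣ image f F ∣ ≡ ∣ F ∣
∣image∣ {b = b} f inj []  = trans (cong ∣_∣ (image-⊥ f)) (∣⊥∣≡0 b)
∣image∣ f inj (false ∷ F) = ∣image∣ (f ∘ suc) (suc-injective ∘ inj) F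
∣image∣ f inj (true ∷ F)  = trans (cong ∣_∣ (image-true∷ f F))
  (trans (∣⁅x⁆∪p∣ (f zero) (image (f ∘ suc) F) f0∉) (cong suc (∣image∣ (f ∘ suc) (suc-injective ∘ inj) F)))
  where
  f0∉ : ¬ lookup (image (f ∘ suc) F) (f zero) ≡ true
  f0∉ f0∈ with ∈-image⁻ (f ∘ suc) F (f zero) f0∈
  ... | i , _ , fi≡f0 with inj fi≡f0
  ...   | ()

∣p∣≡0⇒p≡⊥ : ∀ {n} (p : Subset n) → ∣ p ∣ ≡ 0 → p ≡ ⊥
∣p∣≡0⇒p≡⊥ []          _  = refl
∣p∣≡0⇒p≡⊥ (false ∷ p) eq = cong (false ∷_) (∣p∣≡0⇒p≡⊥ p eq)

∣p∣≡1⇒p≡⁅x⁆ : ∀ {n} (p : Subset n) → ∣ p ∣ ≡ 1 → ∃ λ x → p ≡ ⁅ x ⁆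
∣p∣≡1⇒p≡⁅x⁆ (true  ∷ p) eq = zero , cong (true ∷_) (∣p∣≡0⇒p≡⊥ p (ℕₚ.suc-injective eq))
∣p∣≡1⇒p≡⁅x⁆ (false ∷ p) eq with ∣p∣≡1⇒p≡⁅x⁆ p eq
... | x , p≡ = suc x , cong (false ∷_) p≡

∣p++q∣ : ∀ {m n} (p : Subset m) (q : Subset n) → ∣ p ++ᵥ q ∣ ≡ ∣ p ∣ + ∣ q ∣
∣p++q∣ []          q = refl
∣p++q∣ (true  ∷ p) q = cong suc (∣p++q∣ p q)
∣p++q∣ (false ∷ p) q = ∣p++q∣ p q

sum-lookup : ∀ {n} (p : Subset n) → sum (λ i → ⟦ lookup p i ⟧) ≡ ∣ p ∣
sum-lookup []          = refl
sum-lookup (true  ∷ p) = cong suc (sum-lookup p)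
sum-lookup (false ∷ p) = sum-lookup p

-- Recursion on a runs in step with `_++ᵥ_`, so the image of a concatenated subset can be computed
-- by the same recursion.
glue : ∀ {a b} {A : Set} → (Fin a → A) → (Fin b → A) → Fin (a + b) → A
glue {zero}  f g i       = g i
glue {suc a} f g zero    = f zero
glue {suc a} f g (suc i) = glue (f ∘ suc) g i

glue-avoids : ∀ {a b} {A : Set} (f : Fin a → A) (g : Fin b → A) {y} →
  (∀ i → ¬ y ≡ f i) → (∀ i → ¬ y ≡ g i) → ∀ i → ¬ y ≡ glue f g i
glue-avoids {zero}  f g y∉f y∉g i       = y∉g i
glue-avoids {suc a} f g y∉f y∉g zero    = y∉f zero
glue-avoids {suc a} f g y∉f y∉g (suc i) = glue-avoids (f ∘ suc) g (y∉f ∘ suc) y∉g i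

glue-injective : ∀ {a b} {A : Set} (f : Fin a → A) (g : Fin b → A) → Injective _≡_ _≡_ f → Injective _≡_ _≡_ g →
  (∀ i j → ¬ f i ≡ g j) → Injective _≡_ _≡_ (glue f g)
glue-injective {zero}  f g f-inj g-inj disj eq = g-inj eq
glue-injective {suc a} f g f-inj g-inj disj {zero}  {zero}  eq = refl
glue-injective {suc a} f g f-inj g-inj disj {zero}  {suc j} eq =
  contradiction eq (glue-avoids (f ∘ suc) g (λ i e → contradiction (f-inj e) λ ()) (disj zero) j)
glue-injective {suc a} f g f-inj g-inj disj {suc i} {zero}  eq =
  contradiction (sym eq) (glue-avoids (f ∘ suc) g (λ i e → contradiction (f-inj e) λ ()) (disj zero) i)
glue-injective {suc a} f g f-inj g-inj disj {suc i} {suc j} eq =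
  cong suc (glue-injective (f ∘ suc) g (λ e → suc-injective (f-inj e)) g-inj (disj ∘ suc) eq)

image-glue : ∀ {a b n} (f : Fin a → Fin n) (g : Fin b → Fin n) F F' →
  image (glue f g) (F ++ᵥ F') ≡ image f F ∪ image g F'
image-glue {zero}  f g []          F' = sym (trans (cong (_∪ image g F') (image-⊥ f)) (∪-identityˡ (image g F')))
image-glue {suc a} f g (false ∷ F) F' = image-glue (f ∘ suc) g F F'
image-glue {suc a} f g (true  ∷ F) F' = begin
  image (glue f g) (true ∷ (F ++ᵥ F'))               ≡⟨ image-true∷ (glue f g) (F ++ᵥ F') ⟩
  ⁅ f zero ⁆ ∪ image (glue (f ∘ suc) g) (F ++ᵥ F')   ≡⟨ cong (⁅ f zero ⁆ ∪_) (image-glue (f ∘ suc) g F F') ⟩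
  ⁅ f zero ⁆ ∪ (image (f ∘ suc) F ∪ image g F')      ≡⟨ ∪-assoc ⁅ f zero ⁆ (image (f ∘ suc) F) (image g F') ⟨
  (⁅ f zero ⁆ ∪ image (f ∘ suc) F) ∪ image g F'      ≡⟨ cong (_∪ image g F') (image-true∷ f F) ⟨
  image f (true ∷ F) ∪ image g F'                    ∎
  where open ≡-Reasoning

-- Each forbidden value `f i` removes at most one point of P, so more than m points cannot all be
-- removed.
find-avoiding : ∀ {m n} (f : Fin m → Fin n) (P : Fin n → Bool) → m < sum (λ x → ⟦ P x ⟧) →
  ∃ λ x → P x ≡ true × (∀ i → ¬ x ≡ f i)
find-avoiding {zero} f P 0<ΣP with positive P 0<ΣP
  where
  positive : ∀ {n} (P : Fin n → Bool) → 0 < sum (λ x → ⟦ P x ⟧) → ∃ λ x → P x ≡ true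
  positive {suc n} P 0<ΣP with P zero in P0
  ... | true  = zero , P0
  ... | false with positive (P ∘ suc) 0<ΣP
  ...   | x , Px = suc x , Px
... | x , Px = x , Px , λ ()
find-avoiding {suc m} f P m<ΣP with find-avoiding (f ∘ suc) P' (s≤s⁻¹ (begin-strict
    suc m                                                <⟨ m<ΣP ⟩
    sum (λ x → ⟦ P x ⟧)                                  ≤⟨ sum-mono (λ x → ⟦⟧-split (lookup ⁅ f zero ⁆ x) (P x)) ⟩
    sum (λ x → ⟦ lookup ⁅ f zero ⁆ x ⟧ + ⟦ P' x ⟧)       ≡⟨ ∑-distrib-+ (λ x → ⟦ lookup ⁅ f zero ⁆ x ⟧) (λ x → ⟦ P' x ⟧) ⟩
    sum (λ x → ⟦ lookup ⁅ f zero ⁆ x ⟧) + sum (λ x → ⟦ P' x ⟧)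
      ≡⟨ cong (_+ sum (λ x → ⟦ P' x ⟧)) (trans (sum-lookup ⁅ f zero ⁆) (∣⁅x⁆∣≡1 (f zero))) ⟩
    suc (sum (λ x → ⟦ P' x ⟧))                           ∎))
  where
  open ≤-Reasoning
  P' : _ → Bool
  P' x = not (lookup ⁅ f zero ⁆ x) ∧ P x
... | x , P'x , x∉f = x , proj₂ (∧-true⁻ P'x) , λ
  { zero    refl → not-true⁻ (proj₁ (∧-true⁻ P'x)) (lookup-⁅⁆-refl x)
  ; (suc i) → x∉f i }

-- Greedy choice: each chosen point joins the forbidden ones before the next is picked.
find-transversal : ∀ {v t n} (f : Fin v → Fin n) (P : Fin t → Fin n → Bool) →
  (∀ i → v + t ≤ sum (λ x → ⟦ P i x ⟧)) →
  ∃ λ (g : Fin t → Fin n) → Injective _≡_ _≡_ g × (∀ i j → ¬ f i ≡ g j) × (∀ i → P i (g i) ≡ true)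
find-transversal {t = zero} f P big = (λ ()) , (λ {}) , (λ _ ()) , λ ()
find-transversal {v} {suc t} {n} f P big
  with find-avoiding f (P zero) (≤-trans (s≤s (m≤m+n v t)) (≤-trans (≤-reflexive (sym (+-suc v t))) (big zero)))
... | x , Px , x∉f with find-transversal (x ∷ᶠ f) (P ∘ suc) (λ i → ≤-trans (≤-reflexive (sym (+-suc v t))) (big (suc i)))
  where
  _∷ᶠ_ : ∀ {m} {A : Set} → A → (Fin m → A) → Fin (suc m) → A
  (x ∷ᶠ f) zero    = x
  (x ∷ᶠ f) (suc i) = f i
... | g , g-inj , disj , Pg = g' , g'-inj , disj' , Pg'
  where
  g' : Fin (suc t) → Fin n
  g' zero    = x
  g' (suc i) = g i
  g'-inj : Injective _≡_ _≡_ g'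
  g'-inj {zero}  {zero}  eq = refl
  g'-inj {zero}  {suc j} eq = contradiction eq (disj zero j)
  g'-inj {suc i} {zero}  eq = contradiction (sym eq) (disj zero i)
  g'-inj {suc i} {suc j} eq = cong suc (g-inj eq)
  disj' : ∀ i j → ¬ f i ≡ g' j
  disj' i zero    eq = x∉f i (sym eq)
  disj' i (suc j) eq = disj (suc i) j eq
  Pg' : ∀ i → P i (g' i) ≡ true
  Pg' zero    = Px
  Pg' (suc i) = Pg i

-- Replacing 2-edges by pairs of large codegree

-- Phrased as the absence of a non-neighbour in F, so that it applies to the image of an edge
-- without naming its two endpoints.
common : ∀ {n} → Hypergraph n → Subset n → Fin n → Bool
common G F x = not (anyFin (λ u → lookup F u ∧ not (adj G u x)))

codegree : ∀ {n} → Hypergraph n → Subset n → ℕ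
codegree G F = sum (λ x → ⟦ common G F x ⟧)

thicken : ∀ {n} → ℕ → Hypergraph n → Hypergraph n
thicken K G F = if ∣ F ∣ ≡ᵇ 2 then K ≤ᵇ codegree G F else G F

common⇒adj : ∀ {n} (G : Hypergraph n) F {x} u → common G F x ≡ true → lookup F u ≡ true → adj G u x ≡ true
common⇒adj G F {x} u com u∈F with adj G u x in eq
... | true  = refl
... | false = contradiction (anyFin-true⁺ _ u (∧-true⁺ u∈F (cong not eq))) (not-true⁻ com)

adj⇒common : ∀ {n} (G : Hypergraph n) u w {x} → adj G u x ≡ true → adj G w x ≡ true → common G (⁅ u ⁆ ∪ ⁅ w ⁆) x ≡ true
adj⇒common G u w {x} ux wx = not-true⁺ no-exception
  where
  no-exception : ¬ anyFin (λ y → lookup (⁅ u ⁆ ∪ ⁅ w ⁆) y ∧ not (adj G y x)) ≡ true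
  no-exception any with anyFin-true⁻ _ any
  ... | y , both with ∧-true⁻ both
  ...   | y∈ , ¬yx with ∨-true⁻ (trans (sym (lookup-zipWith _∨_ y ⁅ u ⁆ ⁅ w ⁆)) y∈)
  ...     | inj₁ y∈u = not-true⁻ ¬yx (subst (λ z → adj G z x ≡ true) (lookup-⁅⁆⁻ u y y∈u) ux)
  ...     | inj₂ y∈w = not-true⁻ ¬yx (subst (λ z → adj G z x ≡ true) (lookup-⁅⁆⁻ w y y∈w) wx)

adj-sym : ∀ {n} (G : Hypergraph n) u w → adj G u w ≡ adj G w u
adj-sym G u w = cong (onLevel 2 G) (∪-comm ⁅ u ⁆ ⁅ w ⁆)

sum-⟦⟧≤n : ∀ {n} (p : Fin n → Bool) → sum (λ i → ⟦ p i ⟧) ≤ n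
sum-⟦⟧≤n {n} p = ≤-trans (sum-mono (λ i → ⟦⟧≤1 (p i))) (≤-reflexive (trans (sum-const n 1) (*-identityʳ n)))

thicken-off : ∀ {n} K (G : Hypergraph n) F → ¬ ∣ F ∣ ≡ 2 → G F ≡ thicken K G F
thicken-off K G F ≢2 with ∣ F ∣ ≡ᵇ 2 in eq
... | true  = contradiction (≡ᵇ-reflects-≡ ∣ F ∣ 2 eq) ≢2
... | false = refl

thicken⇒codegree : ∀ {n} K (G : Hypergraph n) F → ∣ F ∣ ≡ 2 → thicken K G F ≡ true → K ≤ codegree G F
thicken⇒codegree K G F ≡2 eq rewrite ≡2 = ≤ᵇ⇒≤ K (codegree G F) (subst T (sym eq) _)

∣pair∣≢2⇒loop : ∀ {n} (u w : Fin n) → ¬ ∣ ⁅ u ⁆ ∪ ⁅ w ⁆ ∣ ≡ 2 → lookup ⁅ u ⁆ w ≡ true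
∣pair∣≢2⇒loop u w ≢2 with u ≟ w
... | yes refl = lookup-⁅⁆-refl u
... | no u≢w   = contradiction (∣pair∣≡2 u≢w) ≢2

module _ {n : ℕ} (K : ℕ) (G : Hypergraph n) where
  private
    a b : Fin n → Fin n → ℕ
    a u w = ⟦ adj G u w ⟧
    b u w = ⟦ adj (thicken K G) u w ⟧

  codegree≤ : ∀ u w → sum (λ v → a u v * a v w) ≤ codegree G (⁅ u ⁆ ∪ ⁅ w ⁆)
  codegree≤ u w = sum-mono (λ v → helper v)
    where
    helper : ∀ v → a u v * a v w ≤ ⟦ common G (⁅ u ⁆ ∪ ⁅ w ⁆) v ⟧
    helper v with adj G u v in uv | adj G v w in vw
    ... | false | _     = z≤n
    ... | true  | false = z≤n
    ... | true  | true  rewrite adj⇒common G u w uv (trans (adj-sym G w v) vw) = ≤-refl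

  walk≤deg : ∀ u w → sum (λ v → a u v * a v w) ≤ sum (a u)
  walk≤deg u w = sum-mono (λ v → ≤-trans (*-monoʳ-≤ (a u v) (⟦⟧≤1 (adj G v w))) (≤-reflexive (*-identityʳ (a u v))))

  -- One summand per case. If u and w are joined in `thicken K G`, the middle vertices are at most
  -- the neighbours of u. If they are distinct and not joined, they have fewer than K common
  -- neighbours. If w = u, no pair is available to pay for the closed walks, and these number at
  -- most n.
  walk-bound : ∀ u w → sum (λ v → a u v * a v w) ≤ b u w * sum (a u) + (K + ⟦ lookup ⁅ u ⁆ w ⟧ * n)
  walk-bound u w with ∣ ⁅ u ⁆ ∪ ⁅ w ⁆ ∣ ≡ᵇ 2 in two
  ... | false rewrite ∣pair∣≢2⇒loop u w (≡ᵇ-reflects-≢ _ 2 two) = ≤-trans (walk≤deg u w) (≤-trans (sum-⟦⟧≤n (adj G u))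
          (≤-trans (≤-reflexive (sym (+-identityʳ n))) (m≤n+m (n + 0) K)))
  ... | true with K ≤ᵇ codegree G (⁅ u ⁆ ∪ ⁅ w ⁆) in big
  ...   | true  = ≤-trans (walk≤deg u w) (≤-trans (≤-reflexive (sym (+-identityʳ _))) (m≤m+n _ _))
  ...   | false = ≤-trans (codegree≤ u w) (≤-trans (<⇒≤ (≰⇒> small)) (m≤m+n K _))
    where
    small : ¬ K ≤ codegree G (⁅ u ⁆ ∪ ⁅ w ⁆)
    small K≤ = subst T big (≤⇒≤ᵇ K≤)

  -- The allowance K is charged for each of the n endpoints, and the closed walks at u cost one
  -- further n; hence `suc K`.
  walks-from : ∀ u → sum (λ w → sum (λ v → a u v * a v w)) ≤ sum (b u) * sum (a u) + suc K * n
  walks-from u = begin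
    sum (λ w → sum (λ v → a u v * a v w))
      ≤⟨ sum-mono (walk-bound u) ⟩
    sum (λ w → b u w * sum (a u) + (K + ⟦ lookup ⁅ u ⁆ w ⟧ * n))
      ≡⟨ ∑-distrib-+ (λ w → b u w * sum (a u)) _ ⟩
    sum (λ w → b u w * sum (a u)) + sum (λ w → K + ⟦ lookup ⁅ u ⁆ w ⟧ * n)
      ≡⟨ cong₂ _+_ (sym (*-distribʳ-sum (sum (a u)) (b u))) rest ⟩
    sum (b u) * sum (a u) + suc K * n ∎
    where
    open ≤-Reasoning
    rest : sum (λ w → K + ⟦ lookup ⁅ u ⁆ w ⟧ * n) ≡ suc K * n
    rest = trans (∑-distrib-+ {n} (λ _ → K) (λ w → ⟦ lookup ⁅ u ⁆ w ⟧ * n)) (trans (cong₂ _+_ (trans (sum-const n K) (*-comm n K))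
      (trans (sym (*-distribʳ-sum n (λ w → ⟦ lookup ⁅ u ⁆ w ⟧))) (trans (cong (_* n) (trans (sum-lookup ⁅ u ⁆) (∣⁅x⁆∣≡1 u))) (*-identityˡ n))))
      (+-comm (K * n) n))

  thicken-degree-sum : ∀ T .{{_ : NonZero T}} →
    T * (2 * countLevel 2 G) ≤ T * (2 * countLevel 2 (thicken K G)) + n * (suc K * n + T * T)
  thicken-degree-sum T = subst₂ (λ e e' → T * e ≤ T * e' + n * (suc K * n + T * T))
    (sym (countLevel-2 n G)) (sym (countLevel-2 n (thicken K G)))
    (degree-sum-bound T (suc K) a b (λ u v → cong ⟦_⟧ (adj-sym G u v)) (λ u → sum-⟦⟧≤n (adj G u)) walks-from)

  -- Passing to `thicken K G` lowers the density of 2-edges by at most 1/m, in the cleared form that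
  -- `h-level-bound` takes. The threshold on n is 4 m T for the shift T chosen below; it makes the
  -- error T² n small compared with T n².
  thicken-edges : ∀ m .{{_ : NonZero m}} → 4 * m * (4 * m * suc K) ≤ n → 2 ≤ n →
    m * countLevel 2 G ≤ m * countLevel 2 (thicken K G) + n C 2
  thicken-edges m {{m≢0}} 4mT≤n 2≤n = *-cancelˡ-≤ (2 * T₀) {{2T≢0}} (begin
    2 * T₀ * (m * e)                                ≡⟨ r₁ m T₀ e ⟩
    m * (T₀ * (2 * e))                              ≤⟨ *-monoʳ-≤ m (thicken-degree-sum T₀ {{T≢0}}) ⟩
    m * (T₀ * (2 * e') + n * (suc K * n + T₀ * T₀)) ≡⟨ r₂ m T₀ e' n (suc K) ⟩
    2 * T₀ * (m * e') + m * (n * (suc K * n + T₀ * T₀)) ≤⟨ +-monoʳ-≤ (2 * T₀ * (m * e')) error ⟩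
    2 * T₀ * (m * e') + 2 * T₀ * D                  ≡⟨ *-distribˡ-+ (2 * T₀) (m * e') D ⟨
    2 * T₀ * (m * e' + D)                           ∎)
    where
    open ≤-Reasoning
    -- With this shift each of the two error terms is at most a quarter of T₀ n².
    T₀ = 4 * m * suc K
    e  = countLevel 2 G
    e' = countLevel 2 (thicken K G)
    D  = n C 2
    T≢0 : NonZero T₀
    T≢0 = m*n≢0 (4 * m) (suc K) {{m*n≢0 4 m}}
    2T≢0 : NonZero (2 * T₀)
    2T≢0 = m*n≢0 2 T₀ {{_}} {{T≢0}}
    r₁ : ∀ m T e → 2 * T * (m * e) ≡ m * (T * (2 * e))
    r₁ = solve-∀
    r₂ : ∀ m T e n k → m * (T * (2 * e) + n * (k * n + T * T)) ≡ 2 * T * (m * e) + m * (n * (k * n + T * T))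
    r₂ = solve-∀
    r₃ : ∀ m n k → 4 * (m * (n * (k * n + 4 * m * k * (4 * m * k))) + 4 * m * k * n)
      ≡ 4 * m * k * (n * n) + n * (4 * m * (4 * m * k)) * (4 * m * k) + 4 * m * k * (n * 2) + 4 * m * k * (n * 2)
    r₃ = solve-∀
    r₄ : ∀ n T → T * (n * n) + n * n * T + T * (n * n) + T * (n * n) ≡ 4 * (T * (n * n))
    r₄ = solve-∀
    r₅ : ∀ T D n → T * (2 * D + n) ≡ 2 * T * D + T * n
    r₅ = solve-∀
    error : m * (n * (suc K * n + T₀ * T₀)) ≤ 2 * T₀ * D
    -- Since 2 D = n² - n, adding T₀ n on both sides avoids truncated subtraction. Besides the two
    -- quarters of T₀ n² used by the error terms, the other two absorb T₀ n by means of 2 ≤ n.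
    error = +-cancelʳ-≤ (T₀ * n) _ _ (*-cancelˡ-≤ 4 (begin
      4 * (m * (n * (suc K * n + T₀ * T₀)) + T₀ * n)
        ≡⟨ r₃ m n (suc K) ⟩
      T₀ * (n * n) + n * (4 * m * T₀) * T₀ + T₀ * (n * 2) + T₀ * (n * 2)
        ≤⟨ +-mono-≤ (+-mono-≤ (+-monoʳ-≤ (T₀ * (n * n)) (*-monoˡ-≤ T₀ (*-monoʳ-≤ n 4mT≤n))) (*-monoʳ-≤ T₀ (*-monoʳ-≤ n 2≤n))) (*-monoʳ-≤ T₀ (*-monoʳ-≤ n 2≤n)) ⟩
      T₀ * (n * n) + n * n * T₀ + T₀ * (n * n) + T₀ * (n * n)
        ≡⟨ r₄ n T₀ ⟩
      4 * (T₀ * (n * n))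
        ≡⟨ cong (λ x → 4 * (T₀ * x)) (2*nC2+n≡n*n n) ⟨
      4 * (T₀ * (2 * D + n))
        ≡⟨ cong (4 *_) (r₅ T₀ D n) ⟩
      4 * (2 * T₀ * D + T₀ * n) ∎))

-- Subdivisions

∈-allSubsets : ∀ {n} (F : Subset n) → F ∈ allSubsets n
∈-allSubsets []          = here refl
∈-allSubsets {suc n} (true  ∷ F) = ∈-++⁺ˡ (∈-map⁺ (true ∷_) (∈-allSubsets F))
∈-allSubsets {suc n} (false ∷ F) = ∈-++⁺ʳ (List.map (true ∷_) (allSubsets n)) (∈-map⁺ (false ∷_) (∈-allSubsets F))

eqℕ-true⁻ : ∀ m n → eqℕ m n ≡ true → m ≡ n
eqℕ-true⁻ m n = ⌊⌋-true⁻ (m ℕ.≟ n)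

eqℕ-true⁺ : ∀ {m n} → m ≡ n → eqℕ m n ≡ true
eqℕ-true⁺ {m} {n} = ⌊⌋-true⁺ (m ℕ.≟ n)

module _ {v : ℕ} (H : Hypergraph v) where

  edge : Fin (numTwoEdges H) → Subset v
  edge = List.lookup (twoEdges H)

  isTwoEdge? : (F : Subset v) → Dec ((H F ∧ eqℕ ∣ F ∣ 2) ≡ true)
  isTwoEdge? F = (H F ∧ eqℕ ∣ F ∣ 2) Data.Bool.≟ true

  edge-∈ : ∀ i → H (edge i) ≡ true × ∣ edge i ∣ ≡ 2
  edge-∈ i with ∧-true⁻ (proj₂ (∈-filter⁻ isTwoEdge? {xs = allSubsets v} (∈-lookup {xs = twoEdges H} i)))
  ... | Hi , ∣i∣ = Hi , eqℕ-true⁻ _ 2 ∣i∣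

  edge-surjective : ∀ F → H F ≡ true → ∣ F ∣ ≡ 2 → ∃ λ i → F ≡ edge i
  edge-surjective F HF ∣F∣≡2 = index F∈ , lookup-index F∈
    where
    F∈ : F ∈ twoEdges H
    F∈ = ∈-filter⁺ isTwoEdge? (∈-allSubsets F) (∧-true⁺ HF (eqℕ-true⁺ ∣F∣≡2))

  -- The body of `subdivide` with the old and new parts as separate arguments: `take` and `drop` do
  -- not compute on a concatenation with a variable left part, so edges are built through this form.
  subdivideParts : Subset v → Subset (numTwoEdges H) → Bool
  subdivideParts L R = (isEmptySub R ∧ H L ∧ not (eqℕ ∣ L ∣ 2))
    ∨ anyFin (λ i → eqSub R ⁅ i ⁆ ∧ eqℕ ∣ L ∣ 1 ∧ eqSub (L ∩ edge i) L)

  subdivide-++ : ∀ L R → subdivide H (L ++ᵥ R) ≡ subdivideParts L R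
  subdivide-++ L R = cong₂ subdivideParts (proj₁ parts) (proj₂ parts)
    where
    parts : take v (L ++ᵥ R) ≡ L × drop v (L ++ᵥ R) ≡ R
    parts = ++-injective (take v (L ++ᵥ R)) L (take++drop≡id v (L ++ᵥ R))

  subdivide-old⁺ : ∀ L → H L ≡ true → ¬ ∣ L ∣ ≡ 2 → subdivide H (L ++ᵥ ⊥) ≡ true
  subdivide-old⁺ L HL ∣L∣≢2 = trans (subdivide-++ L ⊥) (cong (_∨ anyFin (λ i → eqSub ⊥ ⁅ i ⁆ ∧ eqℕ ∣ L ∣ 1 ∧ eqSub (L ∩ edge i) L))
    (∧-true⁺ (eqSub-refl (⊥ {numTwoEdges H})) (∧-true⁺ HL (not-true⁺ (∣L∣≢2 ∘ eqℕ-true⁻ ∣ L ∣ 2)))))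

  subdivide-new⁺ : ∀ u i → lookup (edge i) u ≡ true → subdivide H (⁅ u ⁆ ++ᵥ ⁅ i ⁆) ≡ true
  subdivide-new⁺ u i u∈ = trans (subdivide-++ ⁅ u ⁆ ⁅ i ⁆) (∨-true⁺ʳ {isEmptySub ⁅ i ⁆ ∧ H ⁅ u ⁆ ∧ not (eqℕ ∣ ⁅ u ⁆ ∣ 2)} (anyFin-true⁺ _ i
    (∧-true⁺ (eqSub-refl ⁅ i ⁆) (∧-true⁺ (eqℕ-true⁺ (∣⁅x⁆∣≡1 u)) (subst (λ F → eqSub F ⁅ u ⁆ ≡ true) (sym meet) (eqSub-refl ⁅ u ⁆))))))
    where
    meet : ⁅ u ⁆ ∩ edge i ≡ ⁅ u ⁆
    meet = Subset-ext λ j → trans (lookup-zipWith _∧_ j ⁅ u ⁆ (edge i)) (at j)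
      where
      at : ∀ j → lookup ⁅ u ⁆ j ∧ lookup (edge i) j ≡ lookup ⁅ u ⁆ j
      at j with lookup ⁅ u ⁆ j in eq
      ... | false = refl
      ... | true  = trans (cong (lookup (edge i)) (sym (lookup-⁅⁆⁻ u j eq))) u∈

  subdivide⁻ : ∀ F → subdivide H F ≡ true →
    (∃ λ L → F ≡ L ++ᵥ ⊥ × H L ≡ true × ¬ ∣ L ∣ ≡ 2) ⊎
    (∃ λ u → ∃ λ i → F ≡ ⁅ u ⁆ ++ᵥ ⁅ i ⁆ × lookup (edge i) u ≡ true)
  subdivide⁻ F eq with ∨-true⁻ eq
  ... | inj₁ old with ∧-true⁻ old
  ...   | R≡⊥ , old' with ∧-true⁻ old'
  ...     | HL , ∣L∣≢2 = inj₁ (take v F , trans (sym (take++drop≡id v F)) (cong (take v F ++ᵥ_) (eqSub⇒≡ _ ⊥ R≡⊥))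
                             , HL , not-true⁻ ∣L∣≢2 ∘ eqℕ-true⁺)
  subdivide⁻ F eq | inj₂ new with anyFin-true⁻ _ new
  ... | i , Fi with ∧-true⁻ Fi
  ...   | R≡ , Fi' with ∧-true⁻ Fi'
  ...     | ∣L∣≡1 , L∩e≡L with ∣p∣≡1⇒p≡⁅x⁆ (take v F) (eqℕ-true⁻ _ 1 ∣L∣≡1)
  ...       | u , L≡ = inj₂ (u , i , trans (sym (take++drop≡id v F)) (cong₂ _++ᵥ_ L≡ (eqSub⇒≡ _ ⁅ i ⁆ R≡)) , u∈)
    where
    meet : ⁅ u ⁆ ∩ edge i ≡ ⁅ u ⁆
    meet = subst (λ L → L ∩ edge i ≡ L) L≡ (eqSub⇒≡ _ _ L∩e≡L)
    u∈ : lookup (edge i) u ≡ true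
    u∈ = proj₂ (∧-true⁻ {lookup ⁅ u ⁆ u} (trans (sym (lookup-zipWith _∧_ u ⁅ u ⁆ (edge i)))
           (trans (cong (λ L → lookup L u) meet) (lookup-⁅⁆-refl u))))

  ∣L++⊥∣ : ∀ (L : Subset v) → ∣ L ++ᵥ ⊥ {numTwoEdges H} ∣ ≡ ∣ L ∣
  ∣L++⊥∣ L = trans (∣p++q∣ L ⊥) (trans (cong (λ k → ∣ L ∣ + k) (∣⊥∣≡0 (numTwoEdges H))) (+-identityʳ ∣ L ∣))

  ∣new∣ : ∀ (u : Fin v) i → ∣ ⁅ u ⁆ ++ᵥ ⁅ i ⁆ ∣ ≡ 2
  ∣new∣ u i = trans (∣p++q∣ ⁅ u ⁆ ⁅ i ⁆) (cong₂ _+_ (∣⁅x⁆∣≡1 u) (∣⁅x⁆∣≡1 {numTwoEdges H} i))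

  -- The value v + t is what the greedy choice consumes: whenever a subdivision vertex is placed, at
  -- most v + t - 1 points are occupied by old vertices and earlier choices. Edges of size other
  -- than 2 are carried by f itself, since thickening leaves their levels alone.
  thicken-⊒⇒⊒-subdivide : ∀ {n} (G : Hypergraph n) → H ⊑ thicken (v + numTwoEdges H) G → subdivide H ⊑ G
  thicken-⊒⇒⊒-subdivide {n} G (f , f-inj , f-hom)
    with find-transversal f (λ i → common G (image f (edge i))) (λ i →
      thicken⇒codegree (v + numTwoEdges H) G (image f (edge i)) (trans (∣image∣ f f-inj (edge i)) (proj₂ (edge-∈ i))) (f-hom (edge i) (proj₁ (edge-∈ i))))
  ... | x , x-inj , disj , x-common = glue f x , glue-injective f x f-inj x-inj disj , hom
    where
    hom : ∀ F → subdivide H F ≡ true → G (image (glue f x) F) ≡ true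
    hom F HF with subdivide⁻ F HF
    ... | inj₁ (L , refl , HL , ∣L∣≢2) rewrite image-glue f x L ⊥ | image-⊥ x | ∪-identityʳ (image f L) =
      trans (thicken-off (v + numTwoEdges H) G (image f L) (∣L∣≢2 ∘ trans (sym (∣image∣ f f-inj L)))) (f-hom L HL)
    ... | inj₂ (u , i , refl , u∈) rewrite image-glue f x ⁅ u ⁆ ⁅ i ⁆ | image-⁅⁆ f u | image-⁅⁆ x i =
      proj₂ (∧-true⁻ (common⇒adj G (image f (edge i)) (f u) (x-common i) (∈-image⁺ f (edge i) u u∈)))

-- Edge sizes, admissibility and the lower bound

hasEdgeOfSize⁻ : ∀ {v} (H : Hypergraph v) k → hasEdgeOfSize H k ≡ true → ∃ λ F → H F ≡ true × ∣ F ∣ ≡ k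
hasEdgeOfSize⁻ {v} H k = go (allSubsets v)
  where
  go : ∀ xs → foldr (λ F acc → (H F ∧ eqℕ ∣ F ∣ k) ∨ acc) false xs ≡ true → ∃ λ F → H F ≡ true × ∣ F ∣ ≡ k
  go (F ∷ xs) eq with ∨-true⁻ eq
  ... | inj₁ HF   = F , proj₁ (∧-true⁻ HF) , eqℕ-true⁻ _ k (proj₂ (∧-true⁻ {H F} HF))
  ... | inj₂ rest = go xs rest

hasEdgeOfSize⁺ : ∀ {v} (H : Hypergraph v) F → H F ≡ true → hasEdgeOfSize H ∣ F ∣ ≡ true
hasEdgeOfSize⁺ H F HF = go (∈-allSubsets F)
  where
  go : ∀ {xs} → F ∈ xs → foldr (λ F' acc → (H F' ∧ eqℕ ∣ F' ∣ ∣ F ∣) ∨ acc) false xs ≡ true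
  go (here refl) rewrite HF | eqℕ-true⁺ {∣ F ∣} refl = refl
  go (there F∈)  = ∨-true⁺ʳ (go F∈)

countUpTo-mono : ∀ {p q} m → (∀ k → p k ≡ true → q k ≡ true) → countUpTo p m ≤ countUpTo q m
countUpTo-mono {p} {q} zero p⇒q with p 0 in eq
... | false = z≤n
... | true rewrite p⇒q 0 eq = ≤-refl
countUpTo-mono {p} {q} (suc m) p⇒q with p (suc m) in eq
... | false = ≤-trans (countUpTo-mono m p⇒q) (m≤n+m _ ⟦ q (suc m) ⟧)
... | true rewrite p⇒q (suc m) eq = s≤s (countUpTo-mono m p⇒q)

countUpTo-≤ : ∀ p {m n} → m ℕ.≤′ n → countUpTo p m ≤ countUpTo p n
countUpTo-≤ p ℕ.≤′-refl       = ≤-refl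
countUpTo-≤ p (ℕ.≤′-step {n} m≤n) = ≤-trans (countUpTo-≤ p m≤n) (m≤n+m _ ⟦ p (suc n) ⟧)

countUpTo-remove : ∀ p k m → countUpTo p m ≤ suc (countUpTo (remove k p) m)
countUpTo-remove p k m = ≤-trans (go m) (+-monoˡ-≤ _ (single m))
  where
  swap : ∀ a b c d → (a + b) + (c + d) ≡ (a + c) + (b + d)
  swap = solve-∀
  go : ∀ m → countUpTo p m ≤ countUpTo (_≡ᵇ k) m + countUpTo (remove k p) m
  go zero    = ⟦⟧-split (0 ≡ᵇ k) (p 0)
  go (suc m) = ≤-trans (+-mono-≤ (⟦⟧-split (suc m ≡ᵇ k) (p (suc m))) (go m))
    (≤-reflexive (swap ⟦ suc m ≡ᵇ k ⟧ ⟦ remove k p (suc m) ⟧ (countUpTo (_≡ᵇ k) m) _))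
  none : ∀ m → m < k → countUpTo (_≡ᵇ k) m ≡ 0
  none zero (s≤s _) = refl
  none (suc m) m<k with suc m ≡ᵇ k in eq
  ... | true  = contradiction (≡ᵇ-reflects-≡ (suc m) k eq) (<⇒≢ m<k)
  ... | false = none m (<-trans (n<1+n m) m<k)
  single : ∀ m → countUpTo (_≡ᵇ k) m ≤ 1
  single zero    = ⟦⟧≤1 (0 ≡ᵇ k)
  single (suc m) with suc m ≡ᵇ k in eq
  ... | false = single m
  ... | true  = s≤s (≤-reflexive (none m (≤-reflexive (≡ᵇ-reflects-≡ (suc m) k eq))))

module _ {v : ℕ} (H : Hypergraph v) (H₂ : HasTwoEdge H) where

  hasTwoEdge-subdivide : HasTwoEdge (subdivide H)
  hasTwoEdge-subdivide = new (edge-surjective H (proj₁ H₂) (proj₁ (proj₂ H₂)) (proj₂ (proj₂ H₂)))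
    where
    nonempty : ∀ {n} (F : Subset n) → ∣ F ∣ ≡ 2 → ∃ λ u → lookup F u ≡ true
    nonempty (true  ∷ F) _  = zero , refl
    nonempty (false ∷ F) eq with nonempty F eq
    ... | u , u∈ = suc u , u∈
    new : (∃ λ i → proj₁ H₂ ≡ edge H i) → HasTwoEdge (subdivide H)
    new (i , _) with nonempty (edge H i) (proj₂ (edge-∈ H i))
    ... | u , u∈ = ⁅ u ⁆ ++ᵥ ⁅ i ⁆ , subdivide-new⁺ H u i u∈ , ∣new∣ H u i

  size-subdivide⁻ : ∀ F → subdivide H F ≡ true → ∃ λ L → H L ≡ true × ∣ F ∣ ≡ ∣ L ∣
  size-subdivide⁻ F HF with subdivide⁻ H F HF
  ... | inj₁ (L , refl , HL , _) = L , HL , ∣L++⊥∣ H L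
  ... | inj₂ (u , i , refl , _)  = edge H i , proj₁ (edge-∈ H i) , trans (∣new∣ H u i) (sym (proj₂ (edge-∈ H i)))

  size-subdivide⁺ : ∀ L → H L ≡ true → ∃ λ F → subdivide H F ≡ true × ∣ F ∣ ≡ ∣ L ∣
  size-subdivide⁺ L HL = go (∣ L ∣ ℕ.≟ 2)
    where
    go : Dec (∣ L ∣ ≡ 2) → ∃ λ F → subdivide H F ≡ true × ∣ F ∣ ≡ ∣ L ∣
    go (no ∣L∣≢2)  = L ++ᵥ ⊥ , subdivide-old⁺ H L HL ∣L∣≢2 , ∣L++⊥∣ H L
    go (yes ∣L∣≡2) = let F , HF , ∣F∣≡2 = hasTwoEdge-subdivide in F , HF , trans ∣F∣≡2 (sym ∣L∣≡2)

  -- Every size of H survives: size 2 through the half-edges, any other through the unchanged edge.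
  -- The range of sizes that is searched also grows, from v to v + t.
  numSizes-subdivide : numSizes H ≤ numSizes (subdivide H)
  numSizes-subdivide = ≤-trans (countUpTo-mono v same) (countUpTo-≤ (hasEdgeOfSize (subdivide H)) (≤⇒≤′ (m≤m+n v (numTwoEdges H))))
    where
    same : ∀ k → hasEdgeOfSize H k ≡ true → hasEdgeOfSize (subdivide H) k ≡ true
    same k eq with hasEdgeOfSize⁻ H k eq
    ... | L , HL , refl with size-subdivide⁺ L HL
    ...   | F , HF , ∣F∣≡∣L∣ = trans (cong (hasEdgeOfSize (subdivide H)) (sym ∣F∣≡∣L∣)) (hasEdgeOfSize⁺ (subdivide H) F HF)

  -- Pairs created by thickening have size 2, a size of H by `H₂`. All other edges are edges of G,
  -- and subdivision introduces no sizes that H does not have.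
  thicken-admissible : ∀ {n} (G : Hypergraph n) → Admissible (subdivide H) n G →
    Admissible H n (thicken (v + numTwoEdges H) G)
  thicken-admissible {n} G (G-sizes , H'⋢G) = sizes , H'⋢G ∘ thicken-⊒⇒⊒-subdivide H G
    where
    sizes : thicken (v + numTwoEdges H) G RSub H
    sizes F GF with ∣ F ∣ ℕ.≟ 2
    ... | yes ∣F∣≡2 = proj₁ H₂ , proj₁ (proj₂ H₂) , trans ∣F∣≡2 (sym (proj₂ (proj₂ H₂)))
    ... | no  ∣F∣≢2 with G-sizes F (trans (thicken-off (v + numTwoEdges H) G F ∣F∣≢2) GF)
    ...   | F' , HF' , ∣F∣≡∣F'∣ with size-subdivide⁻ F' HF'
    ...     | L , HL , ∣F'∣≡∣L∣ = L , HL , trans ∣F∣≡∣F'∣ ∣F'∣≡∣L∣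

-- A copy of H would contain the image of its 2-edge, again of size 2 by injectivity, while level 2
-- is empty.
levels-admissible : ∀ {v} (H : Hypergraph v) → HasTwoEdge H → ∀ n → Admissible H n (levels n (remove 2 (hasEdgeOfSize H)))
levels-admissible H (F , HF , ∣F∣≡2) n = sizes , λ (f , f-inj , f-hom) →
  no-two (image f F) (trans (∣image∣ f f-inj F) ∣F∣≡2) (f-hom F HF)
  where
  sizes : levels n (remove 2 (hasEdgeOfSize H)) RSub H
  sizes F eq with hasEdgeOfSize⁻ H ∣ F ∣ (proj₂ (∧-true⁻ eq))
  ... | F' , HF' , ∣F'∣≡∣F∣ = F' , HF' , sym ∣F'∣≡∣F∣
  no-two : ∀ F → ∣ F ∣ ≡ 2 → ¬ levels n (remove 2 (hasEdgeOfSize H)) F ≡ true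
  no-two F ∣F∣≡2 rewrite ∣F∣≡2 = λ ()

-- Discarding size 2 costs at most one of the counted sizes. The hypothesis `v ≤ n` guarantees that
-- every remaining size is a non-empty level on n vertices.
IsPi-lower : ∀ {v} (H : Hypergraph v) → HasTwoEdge H → ∀ {n q} → v ≤ n → IsPi H n q → ι (numSizes H) ℚ.≤ q ℚ.+ 1ℚ
IsPi-lower {v} H H₂ {n} {q} v≤n (_ , max) = begin
  ι (numSizes H)                          ≤⟨ ι-mono (countUpTo-remove (hasEdgeOfSize H) 2 v) ⟩
  ι (1 + countUpTo p v)                   ≡⟨ trans (ι-+ 1 (countUpTo p v)) (ℚₚ.+-comm 1ℚ (ι (countUpTo p v))) ⟩
  ι (countUpTo p v) ℚ.+ 1ℚ                ≤⟨ ℚₚ.+-monoˡ-≤ 1ℚ (h-levels v p v≤n) ⟩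
  h (levels n p) ℚ.+ 1ℚ                   ≤⟨ ℚₚ.+-monoˡ-≤ 1ℚ (max (levels n p) (levels-admissible H H₂ n)) ⟩
  q ℚ.+ 1ℚ                                ∎
  where
  open ℚₚ.≤-Reasoning
  p = remove 2 (hasEdgeOfSize H)

-- π_n(H) is a maximum over a finite set, but containment is not decided here, so
-- its existence is only shown up to double negation; this suffices because ≤ on ℚ is stable.

¬¬-maximum : ∀ {A : Set} (P : A → Set) (val : A → ℚ) xs →
  ¬ ¬ ((∀ {x} → x ∈ xs → ¬ P x) ⊎ ∃ λ x → P x × (∀ {y} → y ∈ xs → P y → val y ℚ.≤ val x))
¬¬-maximum P val []       k = k (inj₁ λ ())
¬¬-maximum {A} P val (x ∷ xs) k = ¬¬-maximum P val xs extend
  where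
  extend : ¬ ((∀ {x} → x ∈ xs → ¬ P x) ⊎ ∃ λ x → P x × (∀ {y} → y ∈ xs → P y → val y ℚ.≤ val x))
  -- P x need not be decidable, so the refutation `k` is used twice: from a proof of P x it is given
  -- x as the maximum, and otherwise it is told that no element satisfies P.
  extend (inj₁ none) = k (inj₁ λ { (here refl) Px → k (inj₂ (x , Px , λ { (here refl) _ → ℚₚ.≤-refl ; (there y∈) Py → contradiction Py (none y∈) }))
                                 ; (there y∈) → none y∈ })
  extend (inj₂ (z , Pz , max)) with ℚₚ.≤-total (val x) (val z)
  ... | inj₁ x≤z = k (inj₂ (z , Pz , λ { (here refl) _ → x≤z ; (there y∈) → max y∈ }))
  ... | inj₂ z≤x = ¬Px→ (λ Px → k (inj₂ (x , Px , λ { (here refl) _ → ℚₚ.≤-refl ; (there y∈) Py → ℚₚ.≤-trans (max y∈ Py) z≤x })))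
    where
    ¬Px→ : ¬ ¬ P x
    ¬Px→ ¬Px = k (inj₂ (z , Pz , λ { (here refl) Px → contradiction Px ¬Px ; (there y∈) → max y∈ }))

branch : ∀ {n} → Hypergraph n → Hypergraph n → Hypergraph (suc n)
branch G₁ G₀ (true  ∷ F) = G₁ F
branch G₁ G₀ (false ∷ F) = G₀ F

allHypergraphs : ∀ n → List (Hypergraph n)
allHypergraphs zero    = (λ _ → true) ∷ (λ _ → false) ∷ []
allHypergraphs (suc n) = cartesianProductWith branch (allHypergraphs n) (allHypergraphs n)

-- Hypergraphs are functions, so the list is complete up to pointwise equality; `h-cong` and
-- `Admissible-cong` transport weights and admissibility along it.
allHypergraphs-complete : ∀ {n} (G : Hypergraph n) → ∃ λ G' → G' ∈ allHypergraphs n × (∀ F → G F ≡ G' F)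
allHypergraphs-complete {zero} G with G [] in eq
... | true  = _ , here refl , λ { [] → eq }
... | false = _ , there (here refl) , λ { [] → eq }
allHypergraphs-complete {suc n} G
  with allHypergraphs-complete (G ∘ (true ∷_)) | allHypergraphs-complete (G ∘ (false ∷_))
... | G₁ , G₁∈ , G≗G₁ | G₀ , G₀∈ , G≗G₀ = branch G₁ G₀ , ∈-cartesianProductWith⁺ branch G₁∈ G₀∈ ,
  λ { (true ∷ F) → G≗G₁ F ; (false ∷ F) → G≗G₀ F }

Admissible-cong : ∀ {v n} (H : Hypergraph v) {G G' : Hypergraph n} → (∀ F → G F ≡ G' F) → Admissible H n G → Admissible H n G'
Admissible-cong H G≗G' (sizes , H⋢G) = (λ F G'F → sizes F (trans (G≗G' F) G'F)) ,
  λ (f , f-inj , f-hom) → H⋢G (f , f-inj , λ F HF → trans (G≗G' _) (f-hom F HF))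

¬¬-IsPi : ∀ {v n} (H : Hypergraph v) {G : Hypergraph n} → Admissible H n G → ¬ ¬ ∃ (IsPi H n)
¬¬-IsPi {n = n} H {G} adm k = ¬¬-maximum (Admissible H n) h (allHypergraphs n) λ
  { (inj₁ none) → let G' , G'∈ , G≗G' = allHypergraphs-complete G in none G'∈ (Admissible-cong H G≗G' adm)
  ; (inj₂ (G* , adm* , max)) → k (h G* , (G* , adm* , refl) , λ G₂ adm₂ →
      let G' , G'∈ , G₂≗G' = allHypergraphs-complete G₂
      in subst (ℚ._≤ h G*) (sym (h-cong G₂≗G')) (max G'∈ (Admissible-cong H G₂≗G' adm₂))) }

-- Degeneracy speaks only of rationals q with `IsPi H n q`; this converts such a bound into one for
-- each admissible hypergraph.
IsPi-upper : ∀ {v n} (H : Hypergraph v) {G : Hypergraph n} {c} → (∀ q → IsPi H n q → q ℚ.≤ c) → Admissible H n G → h G ℚ.≤ c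
IsPi-upper H {G} {c} bound adm = decidable-stable (h G ℚₚ.≤? c) λ hG≰c →
  ¬¬-IsPi H adm λ (q , πq) → hG≰c (ℚₚ.≤-trans (proj₂ πq G adm) (bound q πq))

-- Passage to the limit

halve : ∀ ε → 0ℚ ℚ.< ε → ∃ λ m → inv (suc m) ℚ.+ inv (suc m) ℚ.≤ ε
halve ε 0<ε = go ε (ℚ.positive 0<ε)
  where
  go : ∀ ε → ℚ.Positive ε → ∃ λ m → inv (suc m) ℚ.+ inv (suc m) ℚ.≤ ε
  go ε@(mkℚ +[1+ n ] d _) _ = m , ℚₚ.toℚᵘ-cancel-≤ (begin
    ℚ.toℚᵘ (inv (suc m) ℚ.+ inv (suc m))              ≃⟨ ℚₚ.toℚᵘ-homo-+ (inv (suc m)) (inv (suc m)) ⟩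
    ℚ.toℚᵘ (inv (suc m)) ℚᵘ.+ ℚ.toℚᵘ (inv (suc m))    ≃⟨ ℚᵘₚ.+-cong (ℚₚ.toℚᵘ-fromℚᵘ (mkℚᵘ (ℤ.+ 1) m)) (ℚₚ.toℚᵘ-fromℚᵘ (mkℚᵘ (ℤ.+ 1) m)) ⟩
    mkℚᵘ (ℤ.+ 1) m ℚᵘ.+ mkℚᵘ (ℤ.+ 1) m                    ≤⟨ *≤* (ℤ.+≤+ le) ⟩
    mkℚᵘ +[1+ n ] d                                   ∎)
    where
    open ℚᵘₚ.≤-Reasoning
    -- Here `suc m` is 2 (d + 1), so the two reciprocals add up to 1/(d + 1), and ε has this
    -- denominator and numerator at least 1.
    m = d + suc d
    double : ∀ d → (suc (d + suc d) + 0 + (suc (d + suc d) + 0)) * suc d ≡ suc (d + suc d) * suc (d + suc d)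
    double = solve-∀
    le : (suc m + 0 + (suc m + 0)) * suc d ≤ suc n * (suc m * suc m)
    le = ≤-trans (≤-reflexive (double d)) (m≤m+n _ (n * (suc m * suc m)))

∣-∣-bound : ∀ {q x c} → x ℚ.≤ q → q ℚ.≤ x ℚ.+ c → ℚ.∣ q ℚ.- x ∣ ℚ.≤ c
∣-∣-bound {q} {x} {c} x≤q q≤x+c = subst (ℚ._≤ c) (sym (ℚₚ.0≤p⇒∣p∣≡p 0≤q-x)) (begin
  q ℚ.- x              ≤⟨ ℚₚ.+-monoˡ-≤ (ℚ.- x) q≤x+c ⟩
  (x ℚ.+ c) ℚ.- x      ≡⟨ solve 2 (λ x c → (x :+ c) :- x := c) refl x c ⟩
  c                    ∎)
  where
  open ℚₚ.≤-Reasoning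
  0≤q-x : 0ℚ ℚ.≤ q ℚ.- x
  0≤q-x = subst (ℚ._≤ q ℚ.- x) (ℚₚ.+-inverseʳ x) (ℚₚ.+-monoˡ-≤ (ℚ.- x) x≤q)

∣-∣-bound⁻ : ∀ {q x c} → ℚ.∣ q ℚ.- x ∣ ℚ.≤ c → q ℚ.≤ x ℚ.+ c
∣-∣-bound⁻ {q} {x} {c} le = begin
  q                    ≡⟨ solve 2 (λ q x → q := x :+ (q :- x)) refl q x ⟩
  x ℚ.+ (q ℚ.- x)      ≤⟨ ℚₚ.+-monoʳ-≤ x (ℚₚ.≤-trans (p≤∣p∣ (q ℚ.- x)) le) ⟩
  x ℚ.+ c              ∎
  where
  open ℚₚ.≤-Reasoning
  p≤∣p∣ : ∀ p → p ℚ.≤ ℚ.∣ p ∣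
  p≤∣p∣ p with ℚₚ.≤-total 0ℚ p
  ... | inj₁ 0≤p = ℚₚ.≤-reflexive (sym (ℚₚ.0≤p⇒∣p∣≡p 0≤p))
  ... | inj₂ p≤0 = ℚₚ.≤-trans p≤0 (ℚₚ.0≤∣p∣ p)

-- One 1/m is lost in thickening, the other in the degeneracy of H. The threshold adds up three
-- demands: K, the number of vertices of the subdivision, for the lower bound; 2, for a nonzero
-- `n C 2`; and the size required by `thicken-edges`.
IsPi-subdivide : ∀ {v n} (H : Hypergraph v) → HasTwoEdge H → ∀ m → .{{NonZero m}} →
  let K = v + numTwoEdges H in K + (2 + 4 * m * (4 * m * suc K)) ≤ n →
  (∀ q → IsPi H n q → ℚ.∣ q ℚ.- (ι (numSizes H) ℚ.- 1ℚ) ∣ ℚ.≤ inv m) →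
  ∀ q → IsPi (subdivide H) n q →
  ℚ.∣ q ℚ.- (ι (numSizes (subdivide H)) ℚ.- 1ℚ) ∣ ℚ.≤ inv m ℚ.+ inv m
IsPi-subdivide {v} {n} H H₂ m large bound q π@((G , adm , hG≡q) , _) = ∣-∣-bound lower upper
  where
  open ℚₚ.≤-Reasoning
  K = v + numTwoEdges H
  large′ : 2 + 4 * m * (4 * m * suc K) ≤ n
  large′ = m+n≤o⇒n≤o K large
  2≤n : 2 ≤ n
  2≤n = m+n≤o⇒m≤o 2 large′
  instance
    nC2≢0 : NonZero (n C 2)
    nC2≢0 = C-nonZero 2≤n
  r r′ : ℚ
  r  = ι (numSizes H)
  r′ = ι (numSizes (subdivide H))
  G′ = thicken K G
  lower : r′ ℚ.- 1ℚ ℚ.≤ q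
  lower = ℚₚ.≤-trans
    (ℚₚ.+-monoˡ-≤ (ℚ.- 1ℚ) (IsPi-lower (subdivide H) (hasTwoEdge-subdivide H H₂) (m+n≤o⇒m≤o K large) π))
    (ℚₚ.≤-reflexive (trans (ℚₚ.+-assoc q 1ℚ (ℚ.- 1ℚ)) (ℚₚ.+-identityʳ q)))
  upper : q ℚ.≤ (r′ ℚ.- 1ℚ) ℚ.+ (inv m ℚ.+ inv m)
  upper = begin
    q
      ≡⟨ hG≡q ⟨
    h G
      ≤⟨ h-level-bound m G G′ (thicken-off K G)
           (thicken-edges K G m (m+n≤o⇒n≤o 2 large′) 2≤n) ⟩
    h G′ ℚ.+ inv m
      ≤⟨ ℚₚ.+-monoˡ-≤ (inv m) (IsPi-upper H (λ q πq → ∣-∣-bound⁻ (bound q πq)) (thicken-admissible H H₂ G adm)) ⟩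
    ((r ℚ.- 1ℚ) ℚ.+ inv m) ℚ.+ inv m
      ≡⟨ ℚₚ.+-assoc (r ℚ.- 1ℚ) (inv m) (inv m) ⟩
    (r ℚ.- 1ℚ) ℚ.+ (inv m ℚ.+ inv m)
      ≤⟨ ℚₚ.+-monoˡ-≤ (inv m ℚ.+ inv m) (ℚₚ.+-monoˡ-≤ (ℚ.- 1ℚ) (ι-mono (numSizes-subdivide H H₂))) ⟩
    (r′ ℚ.- 1ℚ) ℚ.+ (inv m ℚ.+ inv m) ∎

theorem5p2 : (v : ℕ) (H : Hypergraph v) → HasTwoEdge H → Degenerate H → Degenerate (subdivide H)
theorem5p2 v H H₂ degenerate ε 0<ε =
  let k , 2/m≤ε = halve ε 0<ε
      N , bound = degenerate (inv (suc k)) (ℚₚ.positive⁻¹ (inv (suc k)) {{ℚₚ.normalize-pos 1 (suc k)}})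
      K = v + numTwoEdges H
      m = suc k
  -- The sum of the two thresholds serves as a bound above both.
  in N + (K + (2 + 4 * m * (4 * m * suc K))) , λ n N≤n q π → ℚₚ.≤-trans
       (IsPi-subdivide H H₂ m (m+n≤o⇒n≤o N N≤n) (bound n (m+n≤o⇒m≤o N N≤n)) q π) 2/m≤ε
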